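{- Let $n$ and $k$ be positive integers with $n \geq 19k-2$. If $T$ is a tournament on $n$ vertices, then $\mathrm{sinv}'_k(T) \leq \mathrm{sinv}_k(T) \leq 1$.
   Context: A tournament is an orientation of a complete graph. For a digraph $D$ and $X \subseteq V(D)$, inverting $X$ means reversing the direction of every arc of $D$ with both endvertices in $X$. A digraph $D$ is $k$-arc-strong if for every partition $(V_1,V_2)$ of $V(D)$ into nonempty sets there are at least $k$ arcs from $V_1$ to $V_2$; it is $k$-strong if $|V(D)|\ge k+1$ and $D-S$ is strongly connected for every $S\subseteq V(D)$ with $|S|<k$. $\mathrm{sinv}'_k(D)$ (resp. $\mathrm{sinv}_k(D)$) is the minimum number of sets whose successive inversion transforms $D$ into a $k$-arc-strong (resp. $k$-strong) digraph. -}

module Defs where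

open import Data.Bool using (Bool; true; false; _∧_; not; if_then_else_; T)
open import Data.Bool.Properties using (T?)
open import Data.Fin using (Fin)
open import Data.Fin.Subset using (Subset; Nonempty; ∁; ∣_∣; _∈_; _∉_)
open import Data.Fin.Subset.Properties using (_∈?_)
open import Data.List using (List; length; filter; foldl; allFin; cartesianProduct)
open import Data.Nat using (ℕ; suc; _≤_; _<_)
open import Data.Product using (∃; _×_; _,_)
open import Data.Vec using (lookup)
open import Relation.Binary.Construct.Closure.ReflexiveTransitive using (Star)
open import Relation.Binary.PropositionalEquality using (_≡_; _≢_)
open import Relation.Nullary using (Dec)
open import Relation.Nullary.Decidable using (_×-dec_)

record Digraph (n : ℕ) : Set where
  field
    arc      : Fin n → Fin n → Bool
    loopless : ∀ v → arc v v ≡ false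

open Digraph public

private
  variable
    n : ℕ

Arc : Digraph n → Fin n → Fin n → Set
Arc D u v = T (arc D u v)

IsTournament : Digraph n → Set
IsTournament D = ∀ u v → u ≢ v → arc D v u ≡ not (arc D u v)

invert : Digraph n → Subset n → Digraph n
invert D X .arc u v = if lookup X u ∧ lookup X v then arc D v u else arc D u v
invert D X .loopless v with lookup X v ∧ lookup X v
... | true  = loopless D v
... | false = loopless D v

invertAll : Digraph n → List (Subset n) → Digraph n
invertAll = foldl invert

Crosses : Digraph n → Subset n → Subset n → Fin n × Fin n → Set
Crosses D X Y (u , v) = u ∈ X × v ∈ Y × Arc D u v

crosses? : (D : Digraph n) (X Y : Subset n) (p : Fin n × Fin n) → Dec (Crosses D X Y p)
crosses? D X Y (u , v) = u ∈? X ×-dec v ∈? Y ×-dec T? (arc D u v)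

arcCount : Digraph n → Subset n → Subset n → ℕ
arcCount {n} D X Y = length (filter (crosses? D X Y) (cartesianProduct (allFin n) (allFin n)))

IsArcStrong : ℕ → Digraph n → Set
IsArcStrong k D = ∀ V₁ → Nonempty V₁ → Nonempty (∁ V₁) → k ≤ arcCount D V₁ (∁ V₁)

ArcAvoiding : Digraph n → Subset n → Fin n → Fin n → Set
ArcAvoiding D S u v = u ∉ S × v ∉ S × Arc D u v

-- D − S is strongly connected: its vertices are the u ∉ S, and any two of them
-- are joined by a directed path all of whose vertices lie outside S.
StronglyConnectedWithout : Digraph n → Subset n → Set
StronglyConnectedWithout D S = ∀ u v → u ∉ S → v ∉ S → Star (ArcAvoiding D S) u v

IsStrong : ℕ → Digraph n → Set
IsStrong {n} k D = suc k ≤ n × (∀ S → ∣ S ∣ < k → StronglyConnectedWithout D S)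

IsMinimum : (ℕ → Set) → ℕ → Set
IsMinimum P m = P m × (∀ j → P j → m ≤ j)

ReachableBy : (Digraph n → Set) → Digraph n → ℕ → Set
ReachableBy {n} P D m = ∃ λ (Xs : List (Subset n)) → length Xs ≡ m × P (invertAll D Xs)

-- sinv′ₖ(D) and sinvₖ(D) need not exist for an arbitrary digraph D, so they are
-- given as relations: "the minimum exists and equals m".
IsSinv′ : ℕ → Digraph n → ℕ → Set
IsSinv′ k D = IsMinimum (ReachableBy (IsArcStrong k) D)

IsSinv : ℕ → Digraph n → ℕ → Set
IsSinv k D = IsMinimum (ReachableBy (IsStrong k) D)

{-# OPTIONS --safe #-}

-- Idea.  Order the vertices so that as many arcs as possible point forward.  Every vertex
-- then dominates at least half of each interval that starts right after it, and is dominated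
-- by at least half of each interval that ends right before it.  Suppose that inverting X and
-- deleting S leaves a set Q without arcs to the remaining vertices N.  Counting interval by
-- interval, after a position of Q the vertices of N outside X are at most as many as those of
-- S ∪ X, and dually for Q before a position of N.  So Q and N can only be separated as "N
-- early, Q late", and X merely has to provide robust connections from the end of the order
-- back to its beginning, as follows (with k for the paper's k − 1).
--
-- Call one of the last 3k + 1 vertices good if it dominates more than k of the first 4k + 1,
-- and symmetrically at the beginning.  If more than k vertices are good at both ends, invert a
-- block of 2k + 1 consecutive central vertices together with those of the first 2k + 1
-- vertices that receive at most k arcs from the block and what follows it, and with those of
-- the last 2k + 1 vertices that send at most k arcs to the block and what precedes it: the
-- inversion turns their arcs with the block around, which gives each of them more than k.
-- Otherwise, say, at least 2k + 1 of the last vertices are bad; a double count shows that at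
-- least 2k + 1 of the first 4k + 1 vertices dominate more than k bad ones, and it suffices to
-- invert these together with the bad vertices.
module Submission where

open import Data.Bool using (Bool; true; false; not; T; _∧_; _∨_; if_then_else_)
open import Data.Bool.Properties using (T?; ∧-zeroʳ)
open import Data.Empty using (⊥; ⊥-elim)
open import Data.Fin using (Fin; fromℕ<)
open import Data.Fin.Properties using (any?; all?) renaming (_≟_ to _≟ᶠ_)
open import Data.Fin.Subset using (Subset; ∣_∣; ⁅_⁆; _∪_; ∁; Nonempty) renaming (_∈_ to _∈ˢ_; _∉_ to _∉ˢ_; ⊥ to ∅; ⊤ to full)
open import Data.Fin.Subset.Properties using (_∈?_; anySubset?; nonempty?; ∣p∣≤n; p⊂q⇒∣p∣<∣q∣; p⊆q⇒∣p∣≤∣q∣; p⊆p∪q; q⊆p∪q; x∈p∪q⁻; x∈⁅x⁆; x∈⁅y⁆⇒x≡y; ∣⁅x⁆∣≡1; ∣⊥∣≡0; ∣⊤∣≡n; x∉p⇒x∈∁p; x∈∁p⇒x∉p; ∉⊥)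
open import Data.List using (List; []; _∷_; _++_; length; filter; map; allFin; tabulate; cartesianProduct)
open import Data.List.Membership.Propositional using (_∈_)
open import Data.List.Membership.Propositional.Properties using (∈-allFin; ∈-filter⁺; ∈-filter⁻; ∈-cartesianProduct⁺; ∈-map⁺; ∈-map⁻)
open import Data.List.Properties using (++-identityʳ; length-++; length-map; length-tabulate)
open import Data.List.Relation.Binary.Permutation.Propositional as Perm using (_↭_; ↭-refl; ↭-sym; ↭-trans; ↭⇒↭ₛ)
open import Data.List.Relation.Binary.Permutation.Propositional.Properties using (∈-resp-↭; ↭-length; ++⁺ˡ; shift)
open import Data.List.Relation.Binary.Permutation.Setoid.Properties using (Unique-resp-↭)
open import Data.List.Relation.Unary.All as All using (All)
open import Data.List.Relation.Unary.AllPairs using (_∷_)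
open import Data.List.Relation.Unary.Any using (here; there)
open import Data.List.Relation.Unary.Unique.Propositional using (Unique)
open import Data.List.Relation.Unary.Unique.Propositional.Properties using (allFin⁺)
open import Data.Nat using (ℕ; zero; suc; _+_; _*_; _∸_; _≤_; _<_; _≥_; z≤n; s≤s; _≤?_; _<?_; _<ᵇ_)
open import Data.Nat.Induction using (<-rec)
open import Data.Nat.Properties
open import Data.Nat.Tactic.RingSolver using (solve-∀)
open import Data.Product using (∃; ∃₂; _×_; _,_; proj₁; proj₂)
open import Data.Sum using (_⊎_; inj₁; inj₂)
open import Data.Unit using (tt)
import Data.Vec as Vec
open import Data.Vec.Properties using (lookup∘tabulate; lookup⇒[]=; []=⇒lookup)
open import Function using (_∘_)
import Function
open import Relation.Binary.Construct.Closure.ReflexiveTransitive using (Star; ε; _◅_; _◅◅_)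
open import Relation.Binary.PropositionalEquality using (_≡_; _≢_; refl; sym; trans; cong; cong₂; subst; subst₂) renaming (setoid to ≡-setoid)
open import Relation.Nullary using (¬_; Dec; yes; no)
open import Relation.Nullary.Decidable using (_×-dec_; _⊎-dec_; _→-dec_; ¬?; map′)
open import Defs

-- Counting in intervals of positions

-- A linear inequality a ≤ b follows from p ≤ q once the identity a + q + d ≡ b + p
-- exhibits a + d − b as p − q without subtraction.
linear : ∀ {a b p q} d → p ≤ q → a + q + d ≡ b + p → a ≤ b
linear {a} {b} {p} {q} d p≤q e = +-cancelʳ-≤ q a b (begin
  a + q      ≤⟨ m≤m+n (a + q) d ⟩
  a + q + d  ≡⟨ e ⟩
  b + p      ≤⟨ +-monoʳ-≤ b p≤q ⟩
  b + q      ∎)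
  where open ≤-Reasoning

-- Refuting form of `linear`: the summed hypotheses `p ≤ q` clash with an identity that puts `p` at
-- least one above `q`, with `d` as the excess beyond that.
linear-⊥ : ∀ {p q} d → p ≤ q → suc q + d ≡ p → ⊥
linear-⊥ {p} {q} d p≤q e = 1+n≰n (≤-trans (m≤m+n (suc q) d) (≤-trans (≤-reflexive e) p≤q))

infixl 6 _⊕_
_⊕_ : ∀ {a b c d} → a ≤ b → c ≤ d → a + c ≤ b + d
_⊕_ = +-mono-≤

true≢false : ∀ {b} → b ≡ true → b ≡ false → ⊥
true≢false refl ()

∨-trueˡ : ∀ {a b} → a ≡ true → a ∨ b ≡ true
∨-trueˡ refl = refl

∨-trueʳ : ∀ {a b} → b ≡ true → a ∨ b ≡ true
∨-trueʳ {true} refl = refl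
∨-trueʳ {false} refl = refl

∨-true : ∀ a {b} → a ∨ b ≡ true → a ≡ true ⊎ b ≡ true
∨-true true p = inj₁ refl
∨-true false p = inj₂ p

∧-trueˡ : ∀ a {b} → a ∧ b ≡ true → a ≡ true
∧-trueˡ true p = refl

∧-trueʳ : ∀ a {b} → a ∧ b ≡ true → b ≡ true
∧-trueʳ true p = p

not-true : ∀ {b} → not b ≡ true → b ≡ false
not-true {false} _ = refl

not-false : ∀ {b} → not b ≡ false → b ≡ true
not-false {true} _ = refl

true-or-not : ∀ b → b ≡ true ⊎ not b ≡ true
true-or-not true  = inj₁ refl
true-or-not false = inj₂ refl

∧-true : ∀ {a b} → a ≡ true → b ≡ true → a ∧ b ≡ true
∧-true refl refl = refl

𝟙 : Bool → ℕ
𝟙 true = 1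
𝟙 false = 0

sumFrom : (ℕ → ℕ) → ℕ → ℕ → ℕ
sumFrom w i zero    = 0
sumFrom w i (suc l) = w i + sumFrom w (suc i) l

count : (ℕ → Bool) → ℕ → ℕ → ℕ
count f = sumFrom (𝟙 ∘ f)

sum-mono : ∀ u w i l → (∀ x → i ≤ x → x < i + l → u x ≤ w x) → sumFrom u i l ≤ sumFrom w i l
sum-mono u w i zero    h = z≤n
sum-mono u w i (suc l) h = h i ≤-refl (m<m+n i (s≤s z≤n)) ⊕
  sum-mono u w (suc i) l (λ x i<x x< → h x (<⇒≤ i<x) (subst (x <_) (sym (+-suc i l)) x<))

sum-split : ∀ w i l m → sumFrom w i (l + m) ≡ sumFrom w i l + sumFrom w (i + l) m
sum-split w i zero    m rewrite +-identityʳ i = refl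
sum-split w i (suc l) m rewrite sum-split w (suc i) l m | +-suc i l = sym (+-assoc (w i) _ _)

sum-+ : ∀ u w i l → sumFrom (λ x → u x + w x) i l ≡ sumFrom u i l + sumFrom w i l
sum-+ u w i zero    = refl
sum-+ u w i (suc l) rewrite sum-+ u w (suc i) l = shuffle (u i) (w i) _ _
  where
  shuffle : ∀ a b c d → a + b + (c + d) ≡ a + c + (b + d)
  shuffle = solve-∀

sum-const : ∀ c i l → sumFrom (λ _ → c) i l ≡ l * c
sum-const c i zero    = refl
sum-const c i (suc l) = cong (c +_) (sum-const c (suc i) l)

sum-*ʳ : ∀ w c i l → sumFrom (λ x → w x * c) i l ≡ sumFrom w i l * c
sum-*ʳ w c i zero = refl
sum-*ʳ w c i (suc l) rewrite sum-*ʳ w c (suc i) l = sym (*-distribʳ-+ c (w i) _)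

sum-swap : ∀ (w : ℕ → ℕ → ℕ) i l j m →
  sumFrom (λ x → sumFrom (w x) j m) i l ≡ sumFrom (λ y → sumFrom (λ x → w x y) i l) j m
sum-swap w i zero    j m = sym (trans (sum-const 0 j m) (*-zeroʳ m))
sum-swap w i (suc l) j m = trans (cong (sumFrom (w i) j m +_) (sum-swap w (suc i) l j m))
  (sym (sum-+ (w i) (λ y → sumFrom (λ x → w x y) (suc i) l) j m))

sum-snoc : ∀ w i l → sumFrom w i (suc l) ≡ sumFrom w i l + w (i + l)
sum-snoc w i l = trans (cong (sumFrom w i) (+-comm 1 l))
  (trans (sum-split w i l 1) (cong (sumFrom w i l +_) (+-identityʳ _)))

𝟙-mono : ∀ {a b} → (a ≡ true → b ≡ true) → 𝟙 a ≤ 𝟙 b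
𝟙-mono {false} h = z≤n
𝟙-mono {true}  h rewrite h refl = ≤-refl

count-mono : ∀ f g i l → (∀ x → i ≤ x → x < i + l → f x ≡ true → g x ≡ true) →
  count f i l ≤ count g i l
count-mono f g i l h = sum-mono _ _ i l (λ x i≤x x< → 𝟙-mono (h x i≤x x<))

count-cong : ∀ f g i l → (∀ x → f x ≡ g x) → count f i l ≡ count g i l
count-cong f g i zero    h = refl
count-cong f g i (suc l) h = cong₂ _+_ (cong 𝟙 (h i)) (count-cong f g (suc i) l h)

count-all : ∀ i l → count (λ _ → true) i l ≡ l
count-all i l = trans (sum-const 1 i l) (*-identityʳ l)

count≤length : ∀ f i l → count f i l ≤ l
count≤length f i l = subst (count f i l ≤_) (count-all i l)
  (count-mono f (λ _ → true) i l (λ _ _ _ _ → refl))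

count-none : ∀ f i l → (∀ x → i ≤ x → x < i + l → f x ≡ false) → count f i l ≤ 0
count-none f i l h = subst (count f i l ≤_) (trans (sum-const 0 i l) (*-zeroʳ l))
  (count-mono f (λ _ → false) i l (λ x p q fx → ⊥-elim (true≢false fx (h x p q))))

count-cover₂ : ∀ f g h i l → (∀ x → i ≤ x → x < i + l → f x ≡ true → g x ≡ true ⊎ h x ≡ true) →
  count f i l ≤ count g i l + count h i l
count-cover₂ f g h i l c = subst (count f i l ≤_) (sum-+ (𝟙 ∘ g) (𝟙 ∘ h) i l)
  (sum-mono _ _ i l (λ x p q → one (f x) (g x) (h x) (c x p q)))
  where
  one : ∀ a b c → (a ≡ true → b ≡ true ⊎ c ≡ true) → 𝟙 a ≤ 𝟙 b + 𝟙 c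
  one false b c h = z≤n
  one true true c h = s≤s z≤n
  one true false true h = ≤-refl
  one true false false h with h refl
  ... | inj₁ ()
  ... | inj₂ ()

length-cover₂ : ∀ g h i l → (∀ x → i ≤ x → x < i + l → g x ≡ true ⊎ h x ≡ true) →
  l ≤ count g i l + count h i l
length-cover₂ g h i l c = subst (_≤ count g i l + count h i l) (count-all i l)
  (count-cover₂ (λ _ → true) g h i l (λ x p q _ → c x p q))

count-disjoint : ∀ f g i l → (∀ x → i ≤ x → x < i + l → f x ≡ true → g x ≡ false) →
  count f i l + count g i l ≤ l
count-disjoint f g i l d = subst₂ _≤_ (sum-+ (𝟙 ∘ f) (𝟙 ∘ g) i l) (count-all i l)
  (sum-mono _ _ i l (λ x p q → one (f x) (g x) (d x p q)))
  where
  one : ∀ a b → (a ≡ true → b ≡ false) → 𝟙 a + 𝟙 b ≤ 1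
  one false false h = z≤n
  one false true  h = ≤-refl
  one true  b     h rewrite h refl = ≤-refl

length-cover₃ : ∀ f g h i l →
  (∀ x → i ≤ x → x < i + l → f x ≡ true ⊎ g x ≡ true ⊎ h x ≡ true) →
  l ≤ count f i l + count g i l + count h i l
length-cover₃ f g h i l c = ≤-trans (length-cover₂ (λ x → f x ∨ g x) h i l either)
  (+-monoˡ-≤ _ (count-cover₂ (λ x → f x ∨ g x) f g i l (λ x _ _ → ∨-true (f x))))
  where
  either : ∀ x → i ≤ x → x < i + l → f x ∨ g x ≡ true ⊎ h x ≡ true
  either x p q with c x p q
  ... | inj₁ fx        = inj₁ (∨-trueˡ fx)
  ... | inj₂ (inj₁ gx) = inj₁ (∨-trueʳ gx)
  ... | inj₂ (inj₂ hx) = inj₂ hx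

count-part : ∀ f i l m → count f i l ≤ count f i (l + m)
count-part f i l m rewrite sum-split (𝟙 ∘ f) i l m = m≤m+n _ _

count-part′ : ∀ f i l m → count f (i + l) m ≤ count f i (l + m)
count-part′ f i l m rewrite sum-split (𝟙 ∘ f) i l m = m≤n+m _ _

count-inside : ∀ f {i l j m} → i ≤ j → j + m ≤ i + l → count f j m ≤ count f i l
count-inside f {i} {l} {j} {m} i≤j j+m≤ with m≤n⇒∃[o]m+o≡n i≤j
... | a , refl with m≤n⇒∃[o]m+o≡n (+-cancelˡ-≤ i (a + m) l (subst (_≤ i + l) (+-assoc i a m) j+m≤))
... | b , refl = ≤-trans (count-part′ f i a m) (count-part f i (a + m) b)

count-support : ∀ f i l d → (∀ x → i + d ≤ x → x < i + l → f x ≡ false) → count f i l ≤ d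
count-support f i l d h with ≤-total l d
... | inj₁ l≤d = ≤-trans (count≤length f i l) l≤d
... | inj₂ d≤l with m≤n⇒∃[o]m+o≡n d≤l
... | m , refl rewrite sum-split (𝟙 ∘ f) i d m = subst (count f i d + count f (i + d) m ≤_) (+-identityʳ d)
  (count≤length f i d ⊕ count-none f (i + d) m (λ x p q → h x p (subst (x <_) (+-assoc i d m) q)))

count-support′ : ∀ f i l d → (∀ x → i ≤ x → x + d < i + l → f x ≡ false) → count f i l ≤ d
count-support′ f i l d h with ≤-total l d
... | inj₁ l≤d = ≤-trans (count≤length f i l) l≤d
... | inj₂ d≤l with m≤n⇒∃[o]m+o≡n d≤l
... | m , refl rewrite +-comm d m | sum-split (𝟙 ∘ f) i m d =
  count-none f i m (λ x p q → h x p (subst (x + d <_) (+-assoc i m d) (+-monoˡ-< d q)))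
  ⊕ count≤length f (i + m) d

-- Applied with `f` the deleted set, which has at most `k` positions: a set with more than `k`
-- positions in an interval has a surviving one there.
count-witness : ∀ f g i l → count f i l < count g i l →
  ∃ λ x → i ≤ x × x < i + l × g x ≡ true × f x ≡ false
count-witness f g i (suc l) c with g i in gi | f i in fi
... | true  | false = i , ≤-refl , m<m+n i (s≤s z≤n) , gi , fi
... | true  | true  = let x , p , q , r = count-witness f g (suc i) l (≤-pred c) in
  x , <⇒≤ p , subst (x <_) (sym (+-suc i l)) q , r
... | false | true  = let x , p , q , r = count-witness f g (suc i) l (<⇒≤ c) in
  x , <⇒≤ p , subst (x <_) (sym (+-suc i l)) q , r
... | false | false = let x , p , q , r = count-witness f g (suc i) l c in
  x , <⇒≤ p , subst (x <_) (sym (+-suc i l)) q , r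

first : ∀ (f : ℕ → Bool) i l → (∀ x → i ≤ x → x < i + l → f x ≡ false) ⊎
  (∃₂ λ a b → l ≡ a + suc b × f (i + a) ≡ true × (∀ x → i ≤ x → x < i + a → f x ≡ false))
first f i zero = inj₁ (λ x p q → ⊥-elim (<⇒≱ q (subst (_≤ x) (sym (+-identityʳ i)) p)))
first f i (suc l) with f i in fi
... | true = inj₂ (0 , l , refl , trans (cong f (+-identityʳ i)) fi ,
  λ x p q → ⊥-elim (<⇒≱ q (subst (_≤ x) (sym (+-identityʳ i)) p)))
... | false with first f (suc i) l
... | inj₁ none = inj₁ λ x p q → step x p (λ i<x → none x i<x (subst (x <_) (+-suc i l) q))
  where
  step : ∀ x → i ≤ x → (i < x → f x ≡ false) → f x ≡ false
  step x p h with m≤n⇒m<n∨m≡n p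
  ... | inj₁ i<x = h i<x
  ... | inj₂ refl = fi
... | inj₂ (a , b , refl , fa , none) = inj₂ (suc a , b , refl , trans (cong f (+-suc i a)) fa ,
  λ x p q → step x p (λ i<x → none x i<x (subst (x <_) (+-suc i a) q)))
  where
  step : ∀ x → i ≤ x → (i < x → f x ≡ false) → f x ≡ false
  step x p h with m≤n⇒m<n∨m≡n p
  ... | inj₁ i<x = h i<x
  ... | inj₂ refl = fi

-- Mirror image of positions; only meaningful for i < n.
mirror : ℕ → ℕ → ℕ
mirror n i = n ∸ suc i

mirror-< : ∀ {n i} → i < n → mirror n i < n
mirror-< {suc n} {i} _ = s≤s (m∸n≤m n i)

mirror-involutive : ∀ {n i} → i < n → mirror n (mirror n i) ≡ i
mirror-involutive {suc n} {i} (s≤s i≤n) = m∸[m∸n]≡n i≤n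

mirror-+ : ∀ a {b n} → a + suc b ≡ n → mirror n a ≡ b
mirror-+ a {b} refl = trans (cong (_∸ suc a) (+-suc a b)) (m+n∸m≡n a b)

mirror-sum : ∀ {n i} → i < n → mirror n i + suc i ≡ n
mirror-sum i<n = m∸n+n≡m i<n

count-mirror : ∀ f n i l m → i + l + m ≡ n → count (f ∘ mirror n) i l ≡ count f m l
count-mirror f n i zero    m e = refl
count-mirror f n i (suc l) m e = trans
  (cong₂ _+_ (cong (𝟙 ∘ f) (mirror-+ i (trans (shuffle i l m) e))) (count-mirror f n (suc i) l m (trans (shuffle′ i l m) e)))
  (trans (+-comm (𝟙 (f (m + l))) (count f m l)) (sym (sum-snoc (𝟙 ∘ f) m l)))
  where
  shuffle : ∀ i l m → i + suc (m + l) ≡ i + suc l + m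
  shuffle = solve-∀
  shuffle′ : ∀ i l m → suc i + l + m ≡ i + suc l + m
  shuffle′ = solve-∀

-- Median orders and cuts

flip : (ℕ → ℕ → Bool) → (ℕ → Bool) → ℕ → ℕ → Bool
flip t X i j = if X i ∧ X j then t j i else t i j

flip-cleanˡ : ∀ t X i j → X i ≡ false → flip t X i j ≡ t i j
flip-cleanˡ t X i j p rewrite p = refl

flip-cleanʳ : ∀ t X i j → X j ≡ false → flip t X i j ≡ t i j
flip-cleanʳ t X i j p rewrite p with X i
... | true  = refl
... | false = refl

flip-dirty : ∀ t X i j → X i ≡ true → X j ≡ true → flip t X i j ≡ t j i
flip-dirty t X i j p q rewrite p | q = refl

-- Vertices are identified with their positions 0, …, n − 1; values beyond n are irrelevant.
record MedianOrder (n : ℕ) : Set where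
  field
    t    : ℕ → ℕ → Bool
    anti : ∀ i j → i < n → j < n → i ≢ j → t j i ≡ not (t i j)
    outs : ∀ i l → suc i + l ≤ n → l ≤ 2 * count (t i) (suc i) l
    ins  : ∀ i l → suc i + l ≤ n → l ≤ 2 * count (λ x → t x (i + l)) i l

-- S is the deleted set and Q has no arc to N after inverting X.  The bound k on the size of S
-- is one less than the connectivity that is being refuted.
record Cut {n : ℕ} (M : MedianOrder n) (X : ℕ → Bool) (k : ℕ) : Set where
  open MedianOrder M
  field
    Q N S  : ℕ → Bool
    some   : ∀ i → i < n → Q i ≡ false → N i ≡ false → S i ≡ true
    Q∩N    : ∀ i → Q i ≡ true → N i ≡ true → ⊥
    closed : ∀ i j → i < n → j < n → Q i ≡ true → N j ≡ true → flip t X i j ≡ false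
    few    : count S 0 n ≤ k

-- Reversing the order and all arcs at once keeps forward arcs forward and exchanges `outs` with
-- `ins`. Arguments about one end thus also serve for the other.
reverseOrder : ∀ {n} → MedianOrder n → MedianOrder n
reverseOrder {n} M = record
  { t    = λ i j → t (mirror n j) (mirror n i)
  ; anti = λ i j i<n j<n i≢j → anti (mirror n j) (mirror n i) (mirror-< j<n) (mirror-< i<n)
             (λ e → i≢j (trans (sym (mirror-involutive i<n))
               (trans (cong (mirror n) (sym e)) (mirror-involutive j<n))))
  ; outs = outs′
  ; ins  = ins′
  }
  where
  open MedianOrder M
  swap₁ : ∀ i l m → i + suc (m + l) ≡ suc i + l + m
  swap₁ = solve-∀
  swap₂ : ∀ i l m → i + l + suc m ≡ suc i + l + m
  swap₂ = solve-∀
  fits : ∀ i l {m} → suc i + l + m ≡ n → suc m + l ≤ n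
  fits i l {m} e = ≤-trans (m≤n+m (suc m + l) i) (≤-reflexive (trans (swap₁ i l m) e))
  outs′ : ∀ i l → suc i + l ≤ n → l ≤ 2 * count (λ x → t (mirror n x) (mirror n i)) (suc i) l
  outs′ i l h with m≤n⇒∃[o]m+o≡n h
  ... | m , e
    rewrite count-mirror (λ y → t y (mirror n i)) n (suc i) l m e
          | mirror-+ i {m + l} (trans (swap₁ i l m) e) = ins m l (fits i l e)
  ins′ : ∀ i l → suc i + l ≤ n → l ≤ 2 * count (λ x → t (mirror n (i + l)) (mirror n x)) i l
  ins′ i l h with m≤n⇒∃[o]m+o≡n h
  ... | m , e
    rewrite count-mirror (t (mirror n (i + l))) n i l (suc m) (trans (swap₂ i l m) e)
          | mirror-+ (i + l) {m} (trans (swap₂ i l m) e) = outs m l (fits i l e)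

flip-mirror : ∀ t X n i j →
  flip (λ i j → t (mirror n j) (mirror n i)) (X ∘ mirror n) i j ≡ flip t X (mirror n j) (mirror n i)
flip-mirror t X n i j with X (mirror n i) | X (mirror n j)
... | true  | true  = refl
... | true  | false = refl
... | false | true  = refl
... | false | false = refl

-- Arcs from `Q` to `N` become arcs from `N` to `Q`, so the two sides exchange roles.
reverseCut : ∀ {n k X} {M : MedianOrder n} → Cut M X k → Cut (reverseOrder M) (X ∘ mirror n) k
reverseCut {n} {k} {X} {M} C = record
  { Q      = N ∘ mirror n
  ; N      = Q ∘ mirror n
  ; S      = S ∘ mirror n
  ; some   = λ i i<n q r → some (mirror n i) (mirror-< i<n) r q
  ; Q∩N    = λ i q r → Q∩N (mirror n i) r q
  ; closed = λ i j i<n j<n q r → trans (flip-mirror t X n i j)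
               (closed (mirror n j) (mirror n i) (mirror-< j<n) (mirror-< i<n) r q)
  ; few    = subst (_≤ k) (sym (count-mirror S n 0 n 0 (+-identityʳ n))) few
  }
  where
  open Cut C
  open MedianOrder M

-- An interval cut at the elements of c falls into intervals free of c, so it suffices to
-- compare q with κ on those.
Balanced : (q c κ : ℕ → Bool) → ℕ → Set
Balanced q c κ j = ∀ i l → i + l ≡ j → (∀ x → i ≤ x → x < j → c x ≡ false) → count q i l ≤ count κ i l

balance : ∀ q c κ j → (∀ x → c x ≡ true → q x ≡ false) →
  (∀ x → x < j → c x ≡ true → Balanced q c κ x) → Balanced q c κ j →
  ∀ i l → i + l ≡ j → count q i l ≤ count κ i l
balance q c κ j disj inner outer i l = <-rec P step l i
  where
  P : ℕ → Set
  P l = ∀ i → i + l ≡ j → count q i l ≤ count κ i l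
  step : ∀ l → (∀ {m} → m < l → P m) → P l
  step l rec i e with first c i l
  ... | inj₁ none = outer i l e (λ x p x<j → none x p (subst (x <_) (sym e) x<j))
  -- The interval is cut at the first element of `c`: `inner` bounds the part before it, by `disj`
  -- the element itself adds nothing to `q`, and `rec` bounds the part after it.
  ... | inj₂ (a , b , refl , ca , none)
    rewrite sum-split (𝟙 ∘ q) i a (suc b) | sum-split (𝟙 ∘ κ) i a (suc b) | disj _ ca =
    inner (i + a) (subst (i + a <_) (trans (+-assoc i a (suc b)) e) (m<m+n (i + a) (s≤s z≤n))) ca i a refl none
    ⊕ ≤-trans (rec (m≤n+m (suc b) a) (suc (i + a)) (trans (shuffle i a b) e)) (m≤n+m _ _)
    where
    shuffle : ∀ i a b → suc (i + a) + b ≡ i + (a + suc b)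
    shuffle = solve-∀

-- Counting bounds and closure properties of a cut

module CutLemmas {n k : ℕ} {X : ℕ → Bool} {M : MedianOrder n} (C : Cut M X k) where
  open MedianOrder M public
  open Cut C public

  cleanQ cleanN blocked blockedN : ℕ → Bool
  cleanQ x   = Q x ∧ not (X x)
  cleanN x   = N x ∧ not (X x)
  blocked x  = S x ∨ X x
  blockedN x = S x ∨ (X x ∧ N x)

  clean⇒ : ∀ {x} (P : ℕ → Bool) → P x ∧ not (X x) ≡ true → P x ≡ true × X x ≡ false
  clean⇒ {x} P h with P x | X x
  ... | true | false = refl , refl

  clean⇐ : ∀ {x} (P : ℕ → Bool) → P x ≡ true → X x ≡ false → P x ∧ not (X x) ≡ true
  clean⇐ P p q rewrite p | q = refl

  no-arcˡ : ∀ {i j} → i < n → j < n → Q i ≡ true → N j ≡ true → X i ≡ false → t i j ≡ false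
  no-arcˡ {i} {j} p q r s c = trans (sym (flip-cleanˡ t X i j c)) (closed i j p q r s)

  no-arcʳ : ∀ {i j} → i < n → j < n → Q i ≡ true → N j ≡ true → X j ≡ false → t i j ≡ false
  no-arcʳ {i} {j} p q r s c = trans (sym (flip-cleanʳ t X i j c)) (closed i j p q r s)

  -- At least half of the interval dominates the position `i + l`, and `q` avoids these
  -- in-neighbours. So `q` is no larger than the set of in-neighbours, all of which lie in `κ`.
  window : ∀ q κ i l → suc i + l ≤ n →
    (∀ x → i ≤ x → x < i + l → q x ≡ true → t x (i + l) ≡ false) →
    (∀ x → i ≤ x → x < i + l → t x (i + l) ≡ true → κ x ≡ true) →
    count q i l ≤ count κ i l
  window q κ i l h q⇒ ⇒κ = linear 0
    (ins i l h ⊕ count-disjoint q inn i l q⇒ ⊕ count-mono inn κ i l ⇒κ)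
    (id (count q i l) (count inn i l) (count κ i l) l)
    where
    inn : ℕ → Bool
    inn x = t x (i + l)
    id : ∀ q c κ l → q + (2 * c + l + κ) + 0 ≡ κ + (l + (q + c) + c)
    id = solve-∀

  -- In an interval without clean positions of `N`, a clean in-neighbour of `j` lies in `S`: its arc
  -- to `j` is not turned, so it is not in `Q`. Hence `window` applies to such intervals, and
  -- `balance` joins them.
  cleanQ≤blocked : ∀ j → j < n → N j ≡ true → ∀ i l → i + l ≡ j →
    count cleanQ i l ≤ count blocked i l
  cleanQ≤blocked j j<n Nj = balance cleanQ cleanN blocked j disj
    (λ x x<j c → win x (<-trans x<j j<n) (proj₁ (clean⇒ N c))) (win j j<n Nj)
    where
    disj : ∀ x → cleanN x ≡ true → cleanQ x ≡ false
    disj x c with Q x in Qx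
    ... | false = refl
    ... | true = ⊥-elim (Q∩N x Qx (proj₁ (clean⇒ N c)))
    win : ∀ j → j < n → N j ≡ true → Balanced cleanQ cleanN blocked j
    win j j<n Nj i l refl none = window cleanQ blocked i l j<n
      (λ x _ x<j c → no-arcˡ (<-trans x<j j<n) j<n (proj₁ (clean⇒ Q c)) Nj (proj₂ (clean⇒ Q c)))
      (λ x p x<j a → case x p x<j a)
      where
      case : ∀ x → i ≤ x → x < i + l → t x (i + l) ≡ true → S x ∨ X x ≡ true
      case x p x<j a with X x in Xx
      ... | true = ∨-trueʳ refl
      ... | false = ∨-trueˡ (some x (<-trans x<j j<n) notQ notN)
        where
        notQ : Q x ≡ false
        notQ with Q x in Qx
        ... | false = refl
        ... | true = ⊥-elim (true≢false a (no-arcˡ (<-trans x<j j<n) j<n Qx Nj Xx))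
        notN : N x ≡ false
        notN with N x in Nx
        ... | false = refl
        ... | true = ⊥-elim (true≢false (clean⇐ N Nx Xx) (none x p x<j))

  -- As `j` itself is clean, even its dirty in-neighbours are not in `Q`, so outside `S` a dirty
  -- vertex is charged only when it belongs to `N`.
  cleanQ≤blockedN : ∀ j → j < n → N j ≡ true → X j ≡ false → ∀ i l → i + l ≡ j →
    count cleanQ i l ≤ count blockedN i l
  cleanQ≤blockedN j j<n Nj Xj = balance cleanQ cleanN blockedN j disj
    (λ x x<j c → win x (<-trans x<j j<n) (proj₁ (clean⇒ N c)) (proj₂ (clean⇒ N c))) (win j j<n Nj Xj)
    where
    disj : ∀ x → cleanN x ≡ true → cleanQ x ≡ false
    disj x c with Q x in Qx
    ... | false = refl
    ... | true = ⊥-elim (Q∩N x Qx (proj₁ (clean⇒ N c)))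
    win : ∀ j → j < n → N j ≡ true → X j ≡ false → Balanced cleanQ cleanN blockedN j
    win j j<n Nj Xj i l refl none = window cleanQ blockedN i l j<n
      (λ x _ x<j c → no-arcˡ (<-trans x<j j<n) j<n (proj₁ (clean⇒ Q c)) Nj (proj₂ (clean⇒ Q c)))
      (λ x p x<j a → case x p x<j a)
      where
      case : ∀ x → i ≤ x → x < i + l → t x (i + l) ≡ true → S x ∨ (X x ∧ N x) ≡ true
      case x p x<j a with N x in Nx
      ... | false = ∨-trueˡ (some x (<-trans x<j j<n) notQ Nx)
        where
        notQ : Q x ≡ false
        notQ with Q x in Qx
        ... | false = refl
        ... | true = ⊥-elim (true≢false a (no-arcʳ (<-trans x<j j<n) j<n Qx Nj Xj))
      ... | true with X x in Xx
      ...   | true  = ∨-trueʳ refl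
      ...   | false = ⊥-elim (true≢false (clean⇐ N Nx Xx) (none x p x<j))

  S-window : ∀ i l → i + l ≤ n → count S i l ≤ k
  S-window i l h = ≤-trans (count-inside S {0} {n} {i} {l} z≤n h) few

  blocked≤ : ∀ i l → i + l ≤ n → count blocked i l ≤ k + count X i l
  blocked≤ i l h = ≤-trans (count-cover₂ blocked S X i l (λ x _ _ → ∨-true (S x)))
    (+-monoˡ-≤ _ (S-window i l h))

  Q-closed : ∀ {i x} → i < n → x < n → Q i ≡ true → flip t X i x ≡ true → S x ≡ false → Q x ≡ true
  Q-closed {i} {x} i<n x<n Qi a Sx with Q x in Qx | N x in Nx
  ... | true  | _ = refl
  ... | false | true = ⊥-elim (true≢false a (closed i x i<n x<n Qi Nx))
  ... | false | false = ⊥-elim (true≢false (some x x<n Qx Nx) Sx)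

  -- More than `k` out-neighbours cannot all be deleted, and a surviving out-neighbour of a position
  -- of `Q` is in `Q` again.
  Q-spreads : ∀ {i} (g : ℕ → Bool) j m → i < n → j + m ≤ n → Q i ≡ true →
    (∀ x → j ≤ x → x < j + m → g x ≡ true → flip t X i x ≡ true) → k < count g j m →
    ∃ λ x → j ≤ x × x < j + m × Q x ≡ true
  Q-spreads {i} g j m i<n h Qi arc more with count-witness S g j m (≤-<-trans (S-window j m h) more)
  ... | x , p , q , gx , Sx = x , p , q , Q-closed i<n (<-≤-trans q h) Qi (arc x p q gx) Sx

  -- The inversion leaves the arcs at a clean position alone, and that position dominates at least
  -- half, hence more than `k`, of the next `2k + 1`.
  jump-clean : ∀ i → Q i ≡ true → X i ≡ false → suc i + suc (2 * k) ≤ n →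
    ∃ λ x → i < x × x < n × Q x ≡ true
  jump-clean i Qi Xi h
    with Q-spreads (t i) (suc i) (suc (2 * k)) (≤-trans (m≤m+n (suc i) _) h) h Qi
      (λ x _ _ a → trans (flip-cleanˡ t X i x Xi) a)
      (*-cancelˡ-< 2 k _ (outs i (suc (2 * k)) h))
  ... | x , p , q , Qx = x , p , <-≤-trans q h , Qx

  -- Here `i` may be dirty. It dominates at least half of the next `d + m` positions and at most `d`
  -- in the skipped part, hence more than `k` of the `m` clean ones once `m` exceeds `2k + d`.
  jump-past : ∀ i d m → Q i ≡ true → suc i + d + m ≤ n → 2 * k + d < m →
    (∀ x → suc i + d ≤ x → x < suc i + d + m → X x ≡ false) →
    ∃ λ x → suc i + d ≤ x × x < suc i + d + m × Q x ≡ true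
  jump-past i d m Qi h small clean = Q-spreads (t i) (suc i + d) m i<n h Qi
    (λ x p q a → trans (flip-cleanʳ t X i x (clean x p q)) a)
    (*-cancelˡ-< 2 k _ (linear 0
      (outs i (d + m) (subst (_≤ n) (+-assoc (suc i) d m) h) ⊕ small
        ⊕ count≤length (t i) (suc i) d ⊕ count≤length (t i) (suc i) d
        ⊕ ≤-reflexive (sum-split (𝟙 ∘ t i) (suc i) d m) ⊕ ≤-reflexive (sum-split (𝟙 ∘ t i) (suc i) d m))
      (id k d m (count (t i) (suc i) d) (count (t i) (suc i + d) m) (count (t i) (suc i) (d + m)))))
    where
    i<n : i < n
    i<n = ≤-trans (m≤m+n (suc i) (d + m)) (subst (_≤ n) (+-assoc (suc i) d m) h)
    id : ∀ k d m a b c → suc (2 * k) + (2 * c + m + d + d + (a + b) + (a + b)) + 0 ≡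
      2 * b + (d + m + suc (2 * k + d) + a + a + c + c)
    id = solve-∀

cleanN≤blocked : ∀ {n k X} {M : MedianOrder n} (C : Cut M X k) → let open CutLemmas C in
  ∀ i l → suc i + l ≤ n → Q i ≡ true → count cleanN (suc i) l ≤ count blocked (suc i) l
cleanN≤blocked {n} {k} {X} {M} C i l h Qi with m≤n⇒∃[o]m+o≡n h
... | m , e = subst₂ _≤_ (count-mirror cleanN n m l (suc i) e′) (count-mirror blocked n m l (suc i) e′)
  (CutLemmas.cleanQ≤blocked (reverseCut C) (mirror n i) (mirror-< i<n)
    (trans (cong Q (mirror-involutive i<n)) Qi) m l (sym (mirror-+ i (trans (shuffle i l m) e))))
  where
  open CutLemmas C using (cleanN; blocked; Q)
  i<n : i < n
  i<n = ≤-trans (m≤m+n (suc i) l) h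
  shuffle : ∀ i l m → i + suc (m + l) ≡ suc i + l + m
  shuffle = solve-∀
  shuffle′ : ∀ i l m → m + l + suc i ≡ suc i + l + m
  shuffle′ = solve-∀
  e′ : m + l + suc i ≡ n
  e′ = trans (shuffle′ i l m) e

-- Few good vertices at one end: the cut argument

clean? : ∀ {n k X} {M : MedianOrder n} (C : Cut M X k) → let open CutLemmas C in
  ∀ x → x < n → cleanN x ≡ true ⊎ cleanQ x ≡ true ⊎ blocked x ≡ true
clean? {X = X} C x x<n with X x in Xx | Q x in Qx | N x in Nx
  where open CutLemmas C
... | true  | _     | _     = inj₂ (inj₂ (∨-trueʳ refl))
... | false | _     | true  = inj₁ refl
... | false | true  | false = inj₂ (inj₁ refl)
... | false | false | false = inj₂ (inj₂ (∨-trueˡ (Cut.some C x x<n Qx Nx)))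

-- Of the clean vertices between a position of Q and a later position of N, few are in N as
-- counted from the former and few are in Q as counted from the latter, so there are few in all.
squeeze : ∀ {n k X} {M : MedianOrder n} (C : Cut M X k) → let open CutLemmas C in
  ∀ i d m c → suc i + d + m ≤ n → Q i ≡ true → count cleanQ (suc i + d) m ≤ c →
  m ≤ 2 * k + count X (suc i) (d + m) + count X (suc i + d) m + c
squeeze {n} {k} {X} C i d m c h Qi few-Q =
  linear 0
    (length-cover₃ cleanN cleanQ blocked lo m (λ x _ x< → clean? C x (<-≤-trans x< h))
      ⊕ count-part′ cleanN (suc i) d m
      ⊕ cleanN≤blocked C i (d + m) h′ Qi
      ⊕ blocked≤ (suc i) (d + m) h′
      ⊕ blocked≤ lo m h ⊕ few-Q)
    (id m k (count cleanN lo m) (count cleanQ lo m) (count blocked lo m) (count cleanN (suc i) (d + m))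
      (count blocked (suc i) (d + m)) (count X (suc i) (d + m)) (count X lo m) c)
  where
  open CutLemmas C
  lo : ℕ
  lo = suc i + d
  h′ : suc i + (d + m) ≤ n
  h′ = subst (_≤ n) (+-assoc (suc i) d m) h
  id : ∀ m k cn cq b cn′ b′ x x′ c →
    m + (cn + cq + b + cn′ + b′ + (k + x) + (k + x′) + c) + 0 ≡
    2 * k + x + x′ + c + (m + cn + cn′ + b′ + b + cq)
  id = solve-∀

-- The situation created by the inversion when one end has few good vertices. The bounds on `α` and
-- `β` agree, although the construction uses `4k + 1` and `3k + 1`, so that reversal preserves the
-- record.
record Linked {n : ℕ} (M : MedianOrder n) (X : ℕ → Bool) (k α γ β : ℕ) : Set where
  open MedianOrder M
  field
    size    : α + γ + β ≡ n
    α≥      : 2 * k + 1 ≤ α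
    α≤      : α ≤ 4 * k + 1
    β≥      : 2 * k + 1 ≤ β
    β≤      : β ≤ 4 * k + 1
    γ≥      : 11 * k + 1 ≤ γ
    middle  : ∀ x → α ≤ x → x < α + γ → X x ≡ false
    back    : ∀ b → α + γ ≤ b → b < n → k < count (flip t X b) 0 α
    forth   : ∀ a → a < α → k < count (λ x → flip t X x a) (α + γ) β

mirror-high : ∀ {n x} a b → a + b ≡ n → a ≤ x → x < n → mirror n x < b
mirror-high {n} {x} a b refl a≤x x<n = +-cancelˡ-≤ x _ _ (begin
  x + suc (mirror n x)  ≡⟨ trans (+-suc x _) (trans (cong suc (+-comm x _)) (sym (+-suc (mirror n x) x))) ⟩
  mirror n x + suc x    ≡⟨ mirror-sum x<n ⟩
  a + b                 ≤⟨ +-monoˡ-≤ b a≤x ⟩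
  x + b                 ∎)
  where open ≤-Reasoning

mirror-low : ∀ {n x} a b → a + b ≡ n → x < a → b ≤ mirror n x
mirror-low {n} {x} a b refl x<a = +-cancelʳ-≤ (suc x) _ _ (begin
  b + suc x             ≤⟨ +-monoʳ-≤ b x<a ⟩
  b + a                 ≡⟨ +-comm b a ⟩
  a + b                 ≡⟨ sym (mirror-sum (<-≤-trans x<a (m≤m+n a b))) ⟩
  mirror n x + suc x    ∎)
  where open ≤-Reasoning

reverseLinked : ∀ {n M X k α γ β} → Linked {n} M X k α γ β →
  Linked (reverseOrder M) (X ∘ mirror n) k β γ α
reverseLinked {n} {M} {X} {k} {α} {γ} {β} L = record
  { size   = e
  ; α≥ = β≥ ; α≤ = β≤ ; β≥ = α≥ ; β≤ = α≤ ; γ≥ = γ≥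
  ; middle = λ x p q → middle (mirror n x) (mirror-low (β + γ) α e q) (mirror-high β (α + γ) (trans (+-comm β _) size) p
               (<-≤-trans q (subst (β + γ ≤_) e (m≤m+n _ α))))
  ; back   = λ b p b<n → subst (k <_)
      (sym (trans (count-cong _ _ 0 β (λ x → flip-mirror t X n b x))
        (count-mirror (λ y → flip t X y (mirror n b)) n 0 β (α + γ) (trans (+-comm β _) size))))
      (forth (mirror n b) (mirror-high (β + γ) α e p b<n))
  ; forth  = λ a p → subst (k <_)
      (sym (trans (count-cong _ _ (β + γ) α (λ x → flip-mirror t X n x a))
        (count-mirror (flip t X (mirror n a)) n (β + γ) α 0 (trans (+-identityʳ _) e))))
      (back (mirror n a) (mirror-low β (α + γ) (trans (+-comm β _) size) p) (mirror-< (<-≤-trans p (subst (β ≤_) size (m≤n+m β _)))))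
  }
  where
  open MedianOrder M
  open Linked L
  e : β + γ + α ≡ n
  e = trans (id α β γ) size
    where
    id : ∀ α β γ → β + γ + α ≡ α + γ + β
    id = solve-∀

-- Before the last block, each position of `Q` yields a later one, so `Q` climbs to the last block;
-- from there `back` carries it into the first.
reach-back : ∀ {n M X k α γ β} → Linked {n} M X k α γ β → (C : Cut M X k) → let open Cut C in
  ∀ i → i < n → Q i ≡ true → ∃ λ a → a < α × Q a ≡ true
reach-back {n} {M} {X} {k} {α} {γ} {β} L C i i<n Qi =
  let b , p , b<n , Qb = last (n ∸ i) i refl i<n Qi
      a , _ , q , Qa = Q-spreads (flip t X b) 0 α b<n α≤n Qb (λ _ _ _ h → h) (back b p b<n)
  in a , q , Qa
  where
  open CutLemmas C
  open Linked L
  α≤n : α ≤ n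
  α≤n = ≤-trans (m≤m+n α γ) (≤-trans (m≤m+n (α + γ) β) (≤-reflexive size))
  next : ∀ i → i < α + γ → Q i ≡ true → ∃ λ x → i < x × x < n × Q x ≡ true
  next i i< Qi with α ≤? i
  ... | yes α≤i = jump-clean i Qi (middle i α≤i i<) (subst (suc i + suc (2 * k) ≤_) size
    (i< ⊕ subst (_≤ β) (+-comm (2 * k) 1) β≥))
  ... | no α≰i with m≤n⇒∃[o]m+o≡n (≰⇒> α≰i)
  ...   | d , refl =
    -- At most `4k` positions of the first block follow `i`, so `2k + d` stays below `6k + 1`.
    let x , p , q , Qx = jump-past i d (6 * k + 1) Qi
          (≤-trans in-middle (subst (α + γ ≤_) size (m≤m+n _ β)))
          (linear i α≤ (id i d k) )
          (λ x p q → middle x p (<-≤-trans q in-middle))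
    in x , ≤-trans (m≤m+n (suc i) d) p ,
       <-≤-trans q (≤-trans in-middle (subst (α + γ ≤_) size (m≤m+n _ β))) , Qx
    where
    in-middle : suc i + d + (6 * k + 1) ≤ α + γ
    in-middle = +-monoʳ-≤ α (≤-trans (linear (5 * k) ≤-refl (id′ k)) γ≥)
      where
      id′ : ∀ k → 6 * k + 1 + 0 + 5 * k ≡ 11 * k + 1 + 0
      id′ = solve-∀
    id : ∀ i d k → suc (2 * k + d) + (4 * k + 1) + i ≡ 6 * k + 1 + suc (i + d)
    id = solve-∀
  last : ∀ f i → n ∸ i ≡ f → i < n → Q i ≡ true → ∃ λ b → α + γ ≤ b × b < n × Q b ≡ true
  last f i e i<n Qi = <-rec P step f i e i<n Qi
    where
    P : ℕ → Set
    P f = ∀ i → n ∸ i ≡ f → i < n → Q i ≡ true → ∃ λ b → α + γ ≤ b × b < n × Q b ≡ true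
    step : ∀ f → (∀ {g} → g < f → P g) → P f
    step f rec i refl i<n Qi with α + γ ≤? i
    ... | yes p = i , p , i<n , Qi
    ... | no p with next i (≰⇒> p) Qi
    ...   | x , i<x , x<n , Qx = rec (∸-monoʳ-< i<x (<⇒≤ x<n)) x refl x<n Qx

-- By `reach-back` and its dual, `Q` has a position in the first block and `N` one in the last. With
-- `Q` early and `N` late, `squeeze` makes the clean middle too short.
linked⇒no-cut : ∀ {n M X k α γ β} → Linked {n} M X k α γ β → (C : Cut M X k) → let open Cut C in
  ∀ i j → i < n → j < n → Q i ≡ true → N j ≡ true → ⊥
linked⇒no-cut {n} {M} {X} {k} {α} {γ} {β} L C i j i<n j<n Qi Nj =
  contra (reach-back L C i i<n Qi)
    (reach-back (reverseLinked L) (reverseCut C) (mirror n j) (mirror-< j<n)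
      (trans (cong N (mirror-involutive j<n)) Nj))
  where
  open CutLemmas C
  open Linked L
  contra : (∃ λ a → a < α × Q a ≡ true) → (∃ λ b → b < β × N (mirror n b) ≡ true) → ⊥
  contra (a , a<α , Qa) (b′ , b′<β , Nb) with m≤n⇒∃[o]m+o≡n a<α
  ... | d , refl with m≤n⇒∃[o]m+o≡n (mirror-low β (α + γ) (trans (+-comm β _) size) b′<β)
  -- Here `d` positions of the first block follow `a` and `d′` of the last precede `b`, both at most
  -- `4k`. So `squeeze` gives `γ ≤ 3k + d + d′ ≤ 11k`, against `γ≥`.
  ...   | d′ , e = linear-⊥ 0
      (squeeze C a d γ (k + d′) (subst (suc a + d + γ ≤_) size (m≤m+n _ β)) Qa few-Q
        ⊕ γ≥
        ⊕ count-support X (suc a) (d + γ) d (λ x p q → middle x p (subst (x <_) (sym (+-assoc (suc a) d γ)) q))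
        ⊕ count-none X (suc a + d) γ middle
        ⊕ d≤ ⊕ d′≤)
      (id k γ d d′ (count X (suc a) (d + γ)) (count X (suc a + d) γ))
    where
    b : ℕ
    b = mirror n b′
    b<n : b < n
    b<n = mirror-< (<-≤-trans b′<β (subst (β ≤_) size (m≤n+m β _)))
    d≤ : d ≤ 4 * k
    d≤ = linear a α≤ (id′ a d k)
      where
      id′ : ∀ a d k → d + (4 * k + 1) + a ≡ 4 * k + suc (a + d)
      id′ = solve-∀
    d′≤ : d′ ≤ 4 * k
    d′≤ = linear 0 (b<n ⊕ β≤ ⊕ ≤-reflexive (sym size) ⊕ ≤-reflexive e) (id′ d′ k b α γ β n)
      where
      id′ : ∀ d′ k b α γ β n → d′ + (n + (4 * k + 1) + (α + γ + β) + b) + 0 ≡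
        4 * k + (suc b + β + n + (α + γ + d′))
      id′ = solve-∀
    few-Q : count cleanQ α γ ≤ k + d′
    few-Q = ≤-trans (count-part cleanQ α γ d′)
      (≤-trans (cleanQ≤blocked b b<n Nb α (γ + d′) (trans (sym (+-assoc α γ d′)) e))
        (≤-trans (blocked≤ α (γ + d′) (<⇒≤ (subst (_< n) (trans (sym e) (+-assoc α γ d′)) b<n)))
          (+-monoʳ-≤ k support)))
      where
      support : count X α (γ + d′) ≤ d′
      support = count-support′ X α (γ + d′) d′ (λ x p q → middle x p
        (+-cancelʳ-< d′ x (α + γ) (subst (x + d′ <_) (sym (+-assoc α γ d′)) q)))
    id : ∀ k γ d d′ x x′ → suc (2 * k + x + x′ + (k + d′) + γ + d + 0 + 4 * k + 4 * k) + 0 ≡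
      γ + (11 * k + 1) + x + x′ + d + d′
    id = solve-∀

-- Good vertices at both ends: the cut argument

ends : ℕ → ℕ
ends k = 2 * k + 1

-- The order consists of blocks of lengths e, r₁, e, r₂, e, where e = 2k + 1; X contains the
-- central block and meets only the two outer ones besides.  The last 3k + 1 positions start at
-- b₀ and the last 4k + 1 at c₀.
record Hubbed {n : ℕ} (M : MedianOrder n) (X : ℕ → Bool) (k r₁ r₂ b₀ c₀ : ℕ) : Set where
  open MedianOrder M
  e : ℕ
  e = ends k
  field
    size   : e + r₁ + e + r₂ + e ≡ n
    b-size : b₀ + (3 * k + 1) ≡ n
    c-size : c₀ + (4 * k + 1) ≡ n
    r₁≥    : 6 * k + 2 ≤ r₁
    r₂≥    : 6 * k + 2 ≤ r₂
    n≥     : 17 * k + 6 ≤ n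
    gap₁   : ∀ x → e ≤ x → x < e + r₁ → X x ≡ false
    centre : ∀ x → e + r₁ ≤ x → x < e + r₁ + e → X x ≡ true
    gap₂   : ∀ x → e + r₁ + e ≤ x → x < e + r₁ + e + r₂ → X x ≡ false
    last-clean  : ∀ b → e + r₁ + e + r₂ ≤ b → b < n → X b ≡ false → k < count (t b) 0 (e + r₁ + e)
    last-dirty  : ∀ b → e + r₁ + e + r₂ ≤ b → b < n → X b ≡ true → count (t b) (e + r₁) e ≤ k
    first-clean : ∀ a → a < e → X a ≡ false → k < count (λ x → t x a) (e + r₁) (e + r₂ + e)
    first-dirty : ∀ a → a < e → X a ≡ true → count (λ x → t x a) (e + r₁) e ≤ k
    goodA goodB : ℕ → Bool
    manyA  : k < count goodA 0 (3 * k + 1)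
    manyB  : k < count goodB b₀ (3 * k + 1)
    goodA⇒ : ∀ a → a < 3 * k + 1 → goodA a ≡ true → X a ≡ false × k < count (λ x → t x a) c₀ (4 * k + 1)
    goodB⇒ : ∀ b → b₀ ≤ b → b < n → goodB b ≡ true → X b ≡ false × k < count (t b) 0 (4 * k + 1)

reverseHubbed : ∀ {n M X k r₁ r₂ b₀ c₀} → Hubbed {n} M X k r₁ r₂ b₀ c₀ →
  Hubbed (reverseOrder M) (X ∘ mirror n) k r₂ r₁ b₀ c₀
reverseHubbed {n} {M} {X} {k} {r₁} {r₂} {b₀} {c₀} H = record
  { size   = size′
  ; b-size = b-size ; c-size = c-size ; r₁≥ = r₂≥ ; r₂≥ = r₁≥ ; n≥ = n≥
  ; gap₁   = λ x p q → gap₂ (mirror n x)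
      (mirror-low (e + r₂) (e + r₁ + e) (trans (id₁ e r₁ r₂) size) q)
      (mirror-high e (e + r₁ + e + r₂) (trans (+-comm e _) size) p (<-≤-trans q z≤))
  ; centre = λ x p q → centre (mirror n x)
      (mirror-low (e + r₂ + e) (e + r₁) (trans (id₂ e r₁ r₂) size) q)
      (mirror-high (e + r₂) (e + r₁ + e) (trans (id₁ e r₁ r₂) size) p (<-≤-trans q w≤))
  ; gap₂   = λ x p q → gap₁ (mirror n x)
      (mirror-low (e + r₂ + e + r₁) e size′ q)
      (mirror-high (e + r₂ + e) (e + r₁) (trans (id₂ e r₁ r₂) size) p (<-≤-trans q f≤))
  ; last-clean  = λ b p b<n Xb → subst (k <_)
      (sym (count-mirror (λ y → t y (mirror n b)) n 0 (e + r₂ + e) (e + r₁) (trans (id₂ e r₁ r₂) size)))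
      (first-clean (mirror n b) (mirror-high (e + r₂ + e + r₁) e size′ p b<n) Xb)
  ; last-dirty  = λ b p b<n Xb → subst (_≤ k)
      (sym (count-mirror (λ y → t y (mirror n b)) n (e + r₂) e (e + r₁) (trans (id₂ e r₁ r₂) size)))
      (first-dirty (mirror n b) (mirror-high (e + r₂ + e + r₁) e size′ p b<n) Xb)
  ; first-clean = λ a a<e Xa → subst (k <_)
      (sym (count-mirror (t (mirror n a)) n (e + r₂) (e + r₁ + e) 0 (trans (id₃ e r₁ r₂) size)))
      (last-clean (mirror n a) (mirror-low e (e + r₁ + e + r₂) (trans (+-comm e _) size) a<e) (mirror-< (<-≤-trans a<e e≤)) Xa)
  ; first-dirty = λ a a<e Xa → subst (_≤ k)
      (sym (count-mirror (t (mirror n a)) n (e + r₂) e (e + r₁) (trans (id₂ e r₁ r₂) size)))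
      (last-dirty (mirror n a) (mirror-low e (e + r₁ + e + r₂) (trans (+-comm e _) size) a<e) (mirror-< (<-≤-trans a<e e≤)) Xa)
  ; goodA  = goodB ∘ mirror n
  ; goodB  = goodA ∘ mirror n
  ; manyA  = subst (k <_) (sym (count-mirror goodB n 0 (3 * k + 1) b₀ (trans (+-comm (3 * k + 1) b₀) b-size))) manyB
  ; manyB  = subst (k <_) (sym (count-mirror goodA n b₀ (3 * k + 1) 0 (trans (+-identityʳ _) b-size))) manyA
  ; goodA⇒ = λ a p g →
      let a<n = <-≤-trans p (subst (3 * k + 1 ≤_) b-size (m≤n+m _ b₀))
          Xa , more = goodB⇒ (mirror n a) (mirror-low (3 * k + 1) b₀ (trans (+-comm (3 * k + 1) b₀) b-size) p) (mirror-< a<n) g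
      in Xa , subst (k <_) (sym (count-mirror (t (mirror n a)) n c₀ (4 * k + 1) 0 (trans (+-identityʳ _) c-size))) more
  ; goodB⇒ = λ b p b<n g →
      let Xb , more = goodA⇒ (mirror n b) (mirror-high b₀ (3 * k + 1) b-size p b<n) g
      in Xb , subst (k <_) (sym (count-mirror (λ y → t y (mirror n b)) n 0 (4 * k + 1) c₀ (trans (+-comm (4 * k + 1) c₀) c-size))) more
  }
  where
  open MedianOrder M
  open Hubbed H
  id₀ : ∀ e r₁ r₂ → e + r₂ + e + r₁ + e ≡ e + r₁ + e + r₂ + e
  id₀ = solve-∀
  id₁ : ∀ e r₁ r₂ → e + r₂ + (e + r₁ + e) ≡ e + r₁ + e + r₂ + e
  id₁ = solve-∀
  id₂ : ∀ e r₁ r₂ → e + r₂ + e + (e + r₁) ≡ e + r₁ + e + r₂ + e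
  id₂ = solve-∀
  id₃ : ∀ e r₁ r₂ → e + r₂ + (e + r₁ + e) + 0 ≡ e + r₁ + e + r₂ + e
  id₃ = solve-∀
  size′ : e + r₂ + e + r₁ + e ≡ n
  size′ = trans (id₀ e r₁ r₂) size
  f≤ : e + r₂ + e + r₁ ≤ n
  f≤ = subst (e + r₂ + e + r₁ ≤_) size′ (m≤m+n _ _)
  w≤ : e + r₂ + e ≤ n
  w≤ = ≤-trans (m≤m+n _ _) f≤
  z≤ : e + r₂ ≤ n
  z≤ = ≤-trans (m≤m+n _ _) w≤
  e≤ : e ≤ n
  e≤ = ≤-trans (m≤m+n _ _) z≤

module HubbedLemmas {n M X k r₁ r₂ b₀ c₀} (H : Hubbed {n} M X k r₁ r₂ b₀ c₀) (C : Cut M X k) where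
  open CutLemmas C
  open Hubbed H

  z w f : ℕ
  z = e + r₁
  w = z + e
  f = w + r₂

  f≤n : f ≤ n
  f≤n = subst (f ≤_) size (m≤m+n _ _)

  w≤n : w ≤ n
  w≤n = ≤-trans (m≤m+n _ _) f≤n

  z≤n′ : z ≤ n
  z≤n′ = ≤-trans (m≤m+n _ _) w≤n

  4k+1≤ : ∀ {r} → 6 * k + 2 ≤ r → 4 * k + 1 ≤ r
  4k+1≤ {r} h = linear (2 * k + 1) h (id k r)
    where
    id : ∀ k r → 4 * k + 1 + r + (2 * k + 1) ≡ r + (6 * k + 2)
    id = solve-∀

  short : ∀ i d → suc i + d ≤ i + e → 2 * k + d < 4 * k + 1
  short i d h = linear 0 h (id i d k)
    where
    id : ∀ i d k → suc (2 * k + d) + (i + (2 * k + 1)) + 0 ≡ 4 * k + 1 + (suc i + d)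
    id = solve-∀

  -- At most `2k` positions of the first block follow `i`, so the first `4k + 1` positions of the
  -- gap are a long enough window for `jump-past`.
  leave-E : ∀ i → i < e → Q i ≡ true → ∃ λ x → e ≤ x × x < z × Q x ≡ true
  leave-E i i<e Qi with m≤n⇒∃[o]m+o≡n i<e
  ... | d , eq =
    let x , p , q , Qx = jump-past i d (4 * k + 1) Qi (≤-trans inside z≤n′)
          (short i d (subst (_≤ i + e) (sym eq) (m≤n+m e i)))
          (λ x p q → gap₁ x (subst (_≤ x) eq p) (<-≤-trans q inside))
    in x , subst (_≤ x) eq p , <-≤-trans q inside , Qx
    where
    inside : suc i + d + (4 * k + 1) ≤ z
    inside = subst (λ y → y + (4 * k + 1) ≤ z) (sym eq) (+-monoʳ-≤ e (4k+1≤ r₁≥))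

  leave-Z : ∀ i → z ≤ i → i < w → Q i ≡ true → ∃ λ x → w ≤ x × x < f × Q x ≡ true
  leave-Z i z≤i i<w Qi with m≤n⇒∃[o]m+o≡n i<w
  ... | d , eq =
    let x , p , q , Qx = jump-past i d (4 * k + 1) Qi (≤-trans inside f≤n)
          (short i d (subst (_≤ i + e) (sym eq) (+-monoˡ-≤ e z≤i)))
          (λ x p q → gap₂ x (subst (_≤ x) eq p) (<-≤-trans q inside))
    in x , subst (_≤ x) eq p , <-≤-trans q inside , Qx
    where
    inside : suc i + d + (4 * k + 1) ≤ f
    inside = subst (λ y → y + (4 * k + 1) ≤ f) (sym eq) (+-monoʳ-≤ w (4k+1≤ r₂≥))

  fits : ∀ i → i < f → suc i + suc (2 * k) ≤ n
  fits i i<f = subst (suc i + suc (2 * k) ≤_) size (i<f ⊕ ≤-reflexive (+-comm 1 (2 * k)))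

  next : ∀ i → i < f → Q i ≡ true → ∃ λ x → i < x × x < n × Q x ≡ true
  next i i<f Qi with e ≤? i | z ≤? i | w ≤? i
  ... | no ¬p | _ | _ = let x , p , q , Qx = leave-E i (≰⇒> ¬p) Qi in
    x , <-≤-trans (≰⇒> ¬p) p , <-≤-trans q z≤n′ , Qx
  ... | yes _ | yes p | no ¬q = let x , p , q , Qx = leave-Z i p (≰⇒> ¬q) Qi in
    x , <-≤-trans (≰⇒> ¬q) p , <-≤-trans q f≤n , Qx
  ... | yes p | no ¬q | _ = jump-clean i Qi (gap₁ i p (≰⇒> ¬q)) (fits i i<f)
  ... | yes _ | yes _ | yes q = jump-clean i Qi (gap₂ i q i<f) (fits i i<f)

  reach-F : ∀ i → i < n → Q i ≡ true → ∃ λ b → f ≤ b × b < n × Q b ≡ true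
  reach-F i = <-rec P step (n ∸ i) i refl
    where
    P : ℕ → Set
    P g = ∀ i → n ∸ i ≡ g → i < n → Q i ≡ true → ∃ λ b → f ≤ b × b < n × Q b ≡ true
    step : ∀ g → (∀ {h} → h < g → P h) → P g
    step g rec i refl i<n Qi with f ≤? i
    ... | yes p = i , p , i<n , Qi
    ... | no p with next i (≰⇒> p) Qi
    ...   | x , i<x , x<n , Qx = rec (∸-monoʳ-< i<x (<⇒≤ x<n)) x refl x<n Qx

  -- A clean `b` has the required arcs by `last-clean`. A dirty one dominates at most `k` of the
  -- `2k + 1` central positions, so more than `k` of them dominate it, and the inversion turns those
  -- arcs around.
  reach-low : ∀ b → f ≤ b → b < n → Q b ≡ true → ∃ λ x → x < w × Q x ≡ true
  reach-low b f≤b b<n Qb with X b in Xb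
  ... | false =
    let x , _ , q , Qx = Q-spreads (t b) 0 w b<n w≤n Qb (λ x _ _ a → trans (flip-cleanˡ t X b x Xb) a)
                           (last-clean b f≤b b<n Xb)
    in x , q , Qx
  ... | true =
    let x , _ , q , Qx = Q-spreads (λ x → t x b) z e b<n w≤n Qb
          (λ x p q a → trans (flip-dirty t X b x Xb (centre x p q)) a) many
    in x , q , Qx
    where
    many : k < count (λ x → t x b) z e
    many = linear 0
      (length-cover₂ (t b) (λ x → t x b) z e (λ x p q → either x q) ⊕ last-dirty b f≤b b<n Xb)
      (id k (count (t b) z e) (count (λ x → t x b) z e))
      where
      id : ∀ k a c → suc k + (a + c + k) + 0 ≡ c + (2 * k + 1 + a)
      id = solve-∀
      either : ∀ x → x < w → t b x ≡ true ⊎ t x b ≡ true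
      either x x<w with t b x in tbx
      ... | true  = inj₁ refl
      ... | false = inj₂ (trans (anti b x b<n (<-≤-trans x<w w≤n) (λ b≡x → <⇒≱ (<-≤-trans x<w (m≤m+n w r₂)) (subst (f ≤_) b≡x f≤b)))
                      (cong not tbx))

  reach-middle : ∀ i → i < n → Q i ≡ true → ∃ λ x → e ≤ x × x < w × Q x ≡ true
  reach-middle i i<n Qi with reach-F i i<n Qi
  ... | b , f≤b , b<n , Qb with reach-low b f≤b b<n Qb
  ...   | x , x<w , Qx with e ≤? x
  ...     | yes p = x , p , x<w , Qx
  ...     | no ¬p = let y , p , q , Qy = leave-E x (≰⇒> ¬p) Qx in y , p , <-≤-trans q (m≤m+n z e) , Qy

  -- Between `e` and the end of the second gap only the `2k + 1` central positions are dirty, so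
  -- `squeeze` yields `2k + (2k + 1) + c`.
  squeeze-middle : ∀ i m c → e ≤ i → i < w → w + m ≤ f → Q i ≡ true → count cleanQ w m ≤ c →
    m ≤ 4 * k + 1 + c
  squeeze-middle i m c e≤i i<w w+m≤f Qi few-Q with m≤n⇒∃[o]m+o≡n i<w
  ... | d , eq = linear 0
    (squeeze C i d m c (≤-trans (≤-reflexive (cong (_+ m) eq)) (≤-trans w+m≤f f≤n)) Qi
        (subst (λ y → count cleanQ y m ≤ c) (sym eq) few-Q)
      ⊕ ≤-reflexive (sum-split (𝟙 ∘ X) (suc i) d m)
      ⊕ count-support′ X (suc i) d e (λ x p q → gap₁ x (≤-trans e≤i (<⇒≤ p))
          (+-cancelʳ-< e x z (subst (x + e <_) eq q)))
      ⊕ none ⊕ none)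
    (id k m c (count X (suc i) (d + m)) (count X (suc i) d) (count X (suc i + d) m))
    where
    none : count X (suc i + d) m ≤ 0
    none = count-none X (suc i + d) m (λ x p q → gap₂ x (subst (_≤ x) eq p)
      (<-≤-trans (subst (λ y → x < y + m) eq q) w+m≤f))
    id : ∀ k m c x x₁ x₂ → m + (2 * k + x + x₂ + c + (x₁ + x₂) + (2 * k + 1) + 0 + 0) + 0 ≡
      4 * k + 1 + c + (m + x + x₁ + x₂ + x₂)
    id = solve-∀

  -- Apply the counting bound at the first position of N in the last block if at most k
  -- positions of that block precede it, and at b otherwise; in the latter case at most k
  -- dirty positions of N precede b, because the block has only 2k + 1 positions.
  few-Q-before-F : ∀ b → f ≤ b → b < n → N b ≡ true → X b ≡ false → count cleanQ w r₂ ≤ 2 * k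
  few-Q-before-F b f≤b b<n Nb Xb with m≤n⇒∃[o]m+o≡n f≤b
  ... | l , refl with first N f (suc l)
  ...   | inj₁ none = ⊥-elim (true≢false Nb (none (f + l) (m≤m+n f l) (+-monoʳ-< f (n<1+n l))))
  ...   | inj₂ (a , l′ , eq , Na , none) with a ≤? k
  ...     | yes a≤k = linear 0
    (count-part cleanQ w r₂ a
      ⊕ cleanQ≤blocked (f + a) fa<n Na w (r₂ + a) (sym (+-assoc w r₂ a))
      ⊕ blocked≤ w (r₂ + a) (<⇒≤ (subst (_< n) (+-assoc w r₂ a) fa<n))
      ⊕ count-support′ X w (r₂ + a) a (λ x p q → gap₂ x p
          (+-cancelʳ-< a x f (subst (x + a <_) (sym (+-assoc w r₂ a)) q)))
      ⊕ a≤k)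
    (id k a (count cleanQ w r₂) (count cleanQ w (r₂ + a)) (count blocked w (r₂ + a)) (count X w (r₂ + a)))
    where
    fa<n : f + a < n
    fa<n = ≤-<-trans (+-monoʳ-≤ f (≤-pred (subst (suc a ≤_) (sym eq) (m≤n⇒m≤n+o′ a l′)))) b<n
      where
      m≤n⇒m≤n+o′ : ∀ a l → suc a ≤ a + suc l
      m≤n⇒m≤n+o′ a l = subst (suc a ≤_) (sym (+-suc a l)) (s≤s (m≤m+n a l))
    id : ∀ k a q q′ b x → q + (q′ + b + (k + x) + a + k) + 0 ≡ 2 * k + (q + q′ + b + x + a)
    id = solve-∀
  ...     | no a≰k = linear 1
    (count-part cleanQ w r₂ l
      ⊕ cleanQ≤blockedN (f + l) b<n Nb Xb w (r₂ + l) (sym (+-assoc w r₂ l))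
      ⊕ count-cover₂ blockedN S dirtyN w (r₂ + l) (λ x _ _ → ∨-true (S x))
      ⊕ S-window w (r₂ + l) (<⇒≤ (subst (_< n) (+-assoc w r₂ l) b<n))
      ⊕ count-support′ dirtyN w (r₂ + l) l′ late
      ⊕ ≰⇒> a≰k ⊕ ≤-reflexive (sym eq) ⊕ l≤)
    (id k a l l′ (count cleanQ w r₂) (count cleanQ w (r₂ + l)) (count blockedN w (r₂ + l))
      (count S w (r₂ + l)) (count dirtyN w (r₂ + l)))
    where
    dirtyN : ℕ → Bool
    dirtyN x = X x ∧ N x
    l≤ : l ≤ 2 * k
    l≤ = linear 0 (b<n ⊕ ≤-reflexive (sym size)) (id f l k n)
      where
      id : ∀ f l k n → l + (n + (f + (2 * k + 1))) + 0 ≡ 2 * k + (suc (f + l) + n)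
      id = solve-∀
    before : ∀ x → x + l′ < w + (r₂ + l) → x < f + a
    before x q = linear 0 (q ⊕ ≤-reflexive eq) (id x l′ w r₂ l a)
      where
      id : ∀ x l′ w r₂ l a → suc x + (w + (r₂ + l) + (a + suc l′)) + 0 ≡ w + r₂ + a + (suc (x + l′) + suc l)
      id = solve-∀
    late : ∀ x → w ≤ x → x + l′ < w + (r₂ + l) → dirtyN x ≡ false
    late x p q with f ≤? x
    ... | no ¬p rewrite gap₂ x p (≰⇒> ¬p) = refl
    ... | yes f≤x rewrite none x f≤x (before x q) = ∧-zeroʳ (X x)
    id : ∀ k a l l′ q q′ b s x →
      q + (q′ + b + (s + x) + k + l′ + a + suc l + 2 * k) + 1 ≡ 2 * k + (q + q′ + b + s + x + suc k + (a + suc l′) + l)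
    id = solve-∀

  -- A clean late position of `N` admits few clean positions of `Q` in the second gap, while
  -- `reach-middle` finds a position of `Q` before that gap. Then `squeeze-middle` bounds the part
  -- of the gap before `b` by less than its length.
  good-N-impossible : ∀ i b → i < n → Q i ≡ true → b₀ ≤ b → b < n → N b ≡ true → X b ≡ false → ⊥
  good-N-impossible i₀ b i₀<n Qi₀ b₀≤b b<n Nb Xb with reach-middle i₀ i₀<n Qi₀
  ... | i , e≤i , i<w , Qi with f ≤? b
  ...   | yes f≤b = linear-⊥ 0
      (squeeze-middle i r₂ (2 * k) e≤i i<w ≤-refl Qi (few-Q-before-F b f≤b b<n Nb Xb) ⊕ r₂≥) (id k r₂)
    where
    id : ∀ k r₂ → suc (4 * k + 1 + 2 * k + r₂) + 0 ≡ r₂ + (6 * k + 2)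
    id = solve-∀
  ...   | no f≰b with m≤n⇒∃[o]m+o≡n w≤b
    where
    w≤b : w ≤ b
    w≤b = linear (5 * k + 2) (b₀≤b ⊕ ≤-reflexive (sym b-size) ⊕ ≤-reflexive size ⊕ r₂≥) (id k w r₂ b b₀ n)
      where
      id : ∀ k w r₂ b b₀ n → w + (b + (b₀ + (3 * k + 1)) + n + r₂) + (5 * k + 2) ≡ b + (b₀ + n + (w + r₂ + (2 * k + 1)) + (6 * k + 2))
      id = solve-∀
  -- Since `b` is among the last `3k + 1` positions, `2k + 1` of which form the last block,
  -- `m ≥ r₂ - k ≥ 5k + 2`; the squeeze allows only `5k + 1`.
  ...     | m , refl = linear-⊥ 0
      (squeeze-middle i m (k + 0) e≤i i<w (<⇒≤ (≰⇒> f≰b)) Qi few-Q ⊕ b₀≤b ⊕ ≤-reflexive (sym b-size) ⊕ ≤-reflexive size ⊕ r₂≥)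
      (id k w r₂ m b₀ n)
    where
    few-Q : count cleanQ w m ≤ k + 0
    few-Q = ≤-trans (cleanQ≤blocked (w + m) b<n Nb w m refl)
      (≤-trans (blocked≤ w m (<⇒≤ b<n))
        (+-monoʳ-≤ k (count-none X w m (λ x p q → gap₂ x p (<-≤-trans q (<⇒≤ (≰⇒> f≰b)))))))
    id : ∀ k w r₂ m b₀ n → suc (4 * k + 1 + (k + 0) + (w + m) + (b₀ + (3 * k + 1)) + n + r₂) + 0 ≡
      m + b₀ + n + (w + r₂ + (2 * k + 1)) + (6 * k + 2)
    id = solve-∀

module HubbedEnds {n M X k r₁ r₂ b₀ c₀} (H : Hubbed {n} M X k r₁ r₂ b₀ c₀) (C : Cut M X k) where
  open CutLemmas C
  open Hubbed H
  open HubbedLemmas H C using (z; w; f; f≤n; w≤n; 4k+1≤)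

  -- The window starts past the possibly dirty rest of the first block. The skipped length `d` costs
  -- twice later, as lost length and as a bound on dirty positions, whence the form of the second
  -- inequality; `right-edge` is dual.
  left-edge : ∀ i → i < 4 * k + 1 → ∃ λ d → e ≤ suc i + d × suc i + d + d ≤ 4 * k + 1
  left-edge i i< with e ≤? i
  ... | yes e≤i = 0 , ≤-trans e≤i (≤-trans (n≤1+n i) (m≤m+n _ 0)) ,
    subst (_≤ 4 * k + 1) (sym (trans (+-identityʳ _) (+-identityʳ _))) i<
  ... | no e≰i with m≤n⇒∃[o]m+o≡n (≰⇒> e≰i)
  ...   | d , eq = d , ≤-reflexive (sym eq) , linear i (≤-reflexive eq ⊕ ≤-reflexive eq) (id i d k)
    where
    id : ∀ i d k → suc i + d + d + (2 * k + 1 + (2 * k + 1)) + i ≡ 4 * k + 1 + (suc i + d + (suc i + d))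
    id = solve-∀

  right-edge : ∀ j → c₀ ≤ j → j < n → ∃₂ λ hi d → hi + d ≡ j × hi ≤ f × n + d ≤ hi + (4 * k + 1)
  right-edge j c₀≤j j<n with f ≤? j
  ... | no f≰j = j , 0 , +-identityʳ j , <⇒≤ (≰⇒> f≰j) ,
    subst₂ _≤_ (trans c-size (sym (+-identityʳ n))) refl (+-monoˡ-≤ (4 * k + 1) c₀≤j)
  ... | yes f≤j with m≤n⇒∃[o]m+o≡n f≤j
  ...   | d , refl = f , d , refl , ≤-refl ,
    linear 0 (≤-reflexive (sym size) ⊕ ≤-reflexive (sym size) ⊕ j<n) (id f d k n)
    where
    id : ∀ f d k n → n + d + (f + (2 * k + 1) + (f + (2 * k + 1)) + n) + 0 ≡ f + (4 * k + 1) + (n + n + suc (f + d))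
    id = solve-∀

  ends-impossible : ∀ i j → i < 4 * k + 1 → Q i ≡ true → c₀ ≤ j → j < n → N j ≡ true → ⊥
  ends-impossible i j i< Qi c₀≤j j<n Nj with left-edge i i< | right-edge j c₀≤j j<n
  ... | d , e≤lo , lo+d≤ | hi , d′ , refl , hi≤f , n+d′≤
    with m≤n⇒∃[o]m+o≡n (≤-trans (m≤m+n _ d) (≤-trans lo+d≤ (≤-trans (4k+1≤ r₁≥) (m≤n+m r₁ e))))
       | m≤n⇒∃[o]m+o≡n w≤hi
    where
    w≤hi : w ≤ hi
    w≤hi = linear (4 * k + 2 + d′) (n+d′≤ ⊕ r₂≥ ⊕ ≤-reflexive size) (id w hi k d′ r₂ n)
      where
      id : ∀ w hi k d′ r₂ n → w + (hi + (4 * k + 1) + r₂ + n) + (4 * k + 2 + d′) ≡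
        hi + (n + d′ + (6 * k + 2) + (w + r₂ + (2 * k + 1)))
      id = solve-∀
  -- By `squeeze`, `m ≤ 3k + 3e + d + d′ = 9k + 3 + d + d′`; the edge bounds and `n ≥ 17k + 6` give
  -- `m ≥ 9k + 4 + d + d′`.
  ...   | m₁ , eq₁ | m₂ , refl = linear-⊥ 0
      (squeeze C i d m (k + (e + d′)) (≤-trans (≤-reflexive lo+m) (≤-trans hi≤f f≤n)) Qi few-Q
        ⊕ ≤-reflexive (sum-split (𝟙 ∘ X) (suc i) d m) ⊕ count≤length X (suc i) d
        ⊕ X-mid ⊕ X-mid ⊕ n+d′≤ ⊕ lo+d≤ ⊕ n≥ ⊕ ≤-reflexive (sym lo+m))
      (id k lo d d′ m n (w + m₂) (count X (suc i) (d + m)) (count X (suc i) d) (count X lo m))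
    where
    lo m : ℕ
    lo = suc i + d
    m  = m₁ + (e + m₂)
    lo+m : lo + m ≡ w + m₂
    lo+m = trans (sym (+-assoc lo m₁ (e + m₂))) (trans (cong (_+ (e + m₂)) eq₁) (sym (+-assoc z e m₂)))
    X-mid : count X lo m ≤ e
    X-mid = begin
      count X lo m                                     ≡⟨ sum-split (𝟙 ∘ X) lo m₁ (e + m₂) ⟩
      count X lo m₁ + count X (lo + m₁) (e + m₂)        ≤⟨ count-none X lo m₁ (λ x p q → gap₁ x (≤-trans e≤lo p) (subst (x <_) eq₁ q)) ⊕ ≤-refl ⟩
      count X (lo + m₁) (e + m₂)                       ≤⟨ count-support X (lo + m₁) (e + m₂) e (λ x p q → gap₂ x
                                                            (subst (λ y → y + e ≤ x) eq₁ p)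
                                                            (<-≤-trans q (≤-trans (≤-reflexive (trans (+-assoc lo m₁ (e + m₂)) lo+m)) hi≤f))) ⟩
      e                                                ∎
      where open ≤-Reasoning
    few-Q : count cleanQ lo m ≤ k + (e + d′)
    few-Q = begin
      count cleanQ lo m           ≤⟨ count-part cleanQ lo m d′ ⟩
      count cleanQ lo (m + d′)    ≤⟨ cleanQ≤blocked (w + m₂ + d′) j<n Nj lo (m + d′) lo+m+d′ ⟩
      count blocked lo (m + d′)   ≤⟨ blocked≤ lo (m + d′) (<⇒≤ (subst (_< n) (sym lo+m+d′) j<n)) ⟩
      k + count X lo (m + d′)     ≡⟨ cong (k +_) (sum-split (𝟙 ∘ X) lo m d′) ⟩
      k + (count X lo m + count X (lo + m) d′)  ≤⟨ +-monoʳ-≤ k (X-mid ⊕ count≤length X (lo + m) d′) ⟩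
      k + (e + d′)                ∎
      where
      open ≤-Reasoning
      lo+m+d′ : lo + (m + d′) ≡ w + m₂ + d′
      lo+m+d′ = trans (sym (+-assoc lo m d′)) (cong (_+ d′) lo+m)
    id : ∀ k lo d d′ m n hi x x₁ x₂ →
      suc (2 * k + x + x₂ + (k + (2 * k + 1 + d′)) + (x₁ + x₂) + d + (2 * k + 1) + (2 * k + 1)
        + (hi + (4 * k + 1)) + (4 * k + 1) + n + (lo + m)) + 0 ≡
      m + x + x₁ + x₂ + x₂ + (n + d′) + (lo + d) + (17 * k + 6) + hi
    id = solve-∀

-- Good vertices `a` and `b` survive at the two ends, and `good-N-impossible` with its dual excludes
-- `b` in `N` and `a` in `Q`. Otherwise the arcs from `b` put `Q` among the first `4k + 1`
-- positions, and those to `a` put `N` among the last, contrary to `ends-impossible`.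
hubbed⇒no-cut : ∀ {n M X k r₁ r₂ b₀ c₀} → Hubbed {n} M X k r₁ r₂ b₀ c₀ → (C : Cut M X k) → let open Cut C in
  ∀ i j → i < n → j < n → Q i ≡ true → N j ≡ true → ⊥
hubbed⇒no-cut {n} {M} {X} {k} {r₁} {r₂} {b₀} {c₀} H C i j i<n j<n Qi Nj
  with count-witness S goodA 0 (3 * k + 1) (≤-<-trans (S-window 0 (3 * k + 1) A≤n) manyA)
     | count-witness S goodB b₀ (3 * k + 1) (≤-<-trans (S-window b₀ (3 * k + 1) (≤-reflexive b-size)) manyB)
  where
  open CutLemmas C
  open Hubbed H
  A≤n : 3 * k + 1 ≤ n
  A≤n = subst (3 * k + 1 ≤_) b-size (m≤n+m _ b₀)
... | a , _ , a<A , ga , Sa | b , b₀≤b , b<B , gb , Sb = by-labels (Q a) refl (N b) refl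
  where
  open CutLemmas C
  open Hubbed H
  a<n : a < n
  a<n = <-≤-trans a<A (subst (3 * k + 1 ≤_) b-size (m≤n+m _ b₀))
  b<n : b < n
  b<n = subst (b <_) b-size b<B
  other : ∀ x → x < n → S x ≡ false → Q x ≡ false → N x ≡ true
  other x x<n Sx Qx with N x in Nx
  ... | true  = refl
  ... | false = ⊥-elim (true≢false (some x x<n Qx Nx) Sx)
  other′ : ∀ x → x < n → S x ≡ false → N x ≡ false → Q x ≡ true
  other′ x x<n Sx Nx with Q x in Qx
  ... | true  = refl
  ... | false = ⊥-elim (true≢false (some x x<n Qx Nx) Sx)
  Xa : X a ≡ false
  Xa = proj₁ (goodA⇒ a a<A ga)
  Xb : X b ≡ false
  Xb = proj₁ (goodB⇒ b b₀≤b b<n gb)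
  by-labels : ∀ q → Q a ≡ q → ∀ r → N b ≡ r → ⊥
  by-labels _ _ true Nb = HubbedLemmas.good-N-impossible H C i b i<n Qi b₀≤b b<n Nb Xb
  by-labels true Qa _ _ = HubbedLemmas.good-N-impossible (reverseHubbed H) (reverseCut C)
    (mirror n j) (mirror n a) (mirror-< j<n) (trans (cong N (mirror-involutive j<n)) Nj)
    (mirror-low (3 * k + 1) b₀ (trans (+-comm (3 * k + 1) b₀) b-size) a<A) (mirror-< a<n)
    (trans (cong Q (mirror-involutive a<n)) Qa) (trans (cong X (mirror-involutive a<n)) Xa)
  by-labels false Qa false Nb =
    let x , _ , x< , Qx = Q-spreads (t b) 0 (4 * k + 1) b<n (subst (4 * k + 1 ≤_) c-size (m≤n+m _ c₀))
          (other′ b b<n Sb Nb) (λ y _ _ h → trans (flip-cleanˡ t X b y Xb) h) (proj₂ (goodB⇒ b b₀≤b b<n gb))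
        y , c₀≤y , y< , tya , Sy = count-witness S (λ y → t y a) c₀ (4 * k + 1)
          (≤-<-trans (S-window c₀ (4 * k + 1) (≤-reflexive c-size)) (proj₂ (goodA⇒ a a<A ga)))
        y<n = subst (y <_) c-size y<
    in HubbedEnds.ends-impossible H C x y x< Qx c₀≤y y<n (late-N y y<n tya Sy)
    where
    late-N : ∀ y → y < n → t y a ≡ true → S y ≡ false → N y ≡ true
    late-N y y<n tya Sy = other y y<n Sy not-Q
      where
      not-Q : Q y ≡ false
      not-Q with Q y in Qy
      ... | false = refl
      ... | true  = ⊥-elim (true≢false tya (no-arcʳ y<n a<n Qy (other a a<n Sa Qa) Xa))

-- Choice of the inverted set

<ᵇ-true : ∀ {a b} → (a <ᵇ b) ≡ true → a < b
<ᵇ-true {a} {b} h = <ᵇ⇒< a b (subst T (sym h) tt)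

<ᵇ-false : ∀ {a b} → (a <ᵇ b) ≡ false → b ≤ a
<ᵇ-false h = ≮⇒≥ (λ a<b → subst T h (<⇒<ᵇ a<b))

<⇒<ᵇ-true : ∀ {a b} → a < b → (a <ᵇ b) ≡ true
<⇒<ᵇ-true {a} {b} h with a <ᵇ b in eq
... | true  = refl
... | false = ⊥-elim (<⇒≱ h (<ᵇ-false eq))

≥⇒<ᵇ-false : ∀ {a b} → b ≤ a → (a <ᵇ b) ≡ false
≥⇒<ᵇ-false {a} {b} h with a <ᵇ b in eq
... | false = refl
... | true  = ⊥-elim (<⇒≱ (<ᵇ-true eq) h)

if-true : ∀ {A : Set} {b} {x y : A} → b ≡ true → (if b then x else y) ≡ x
if-true refl = refl

if-false : ∀ {A : Set} {b} {x y z : A} → b ≡ false → y ≡ z → (if b then x else y) ≡ z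
if-false refl e = e

-- A `Cut` may have an empty side, so what is excluded is a cut with a position on both sides.
NoCut : ∀ {n} → MedianOrder n → (ℕ → Bool) → ℕ → Set
NoCut {n} M X k = (C : Cut M X k) → let open Cut C in
  ∀ i j → i < n → j < n → Q i ≡ true → N j ≡ true → ⊥

good-out : ∀ {n} → MedianOrder n → ℕ → ℕ → Bool
good-out M k b = k <ᵇ count (MedianOrder.t M b) 0 (4 * k + 1)

good-in : ∀ {n} → MedianOrder n → (k c₀ : ℕ) → ℕ → Bool
good-in M k c₀ a = k <ᵇ count (λ x → MedianOrder.t M x a) c₀ (4 * k + 1)

module Balanced-Ends {n : ℕ} (M : MedianOrder n) (k s b₀ c₀ : ℕ)
  (n-size : 19 * k + 17 + s ≡ n) (b-size : b₀ + (3 * k + 1) ≡ n) (c-size : c₀ + (4 * k + 1) ≡ n)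
  (manyA : k < count (good-in M k c₀) 0 (3 * k + 1)) (manyB : k < count (good-out M k) b₀ (3 * k + 1))
  where
  open MedianOrder M

  e r₁ r₂ z w f : ℕ
  e  = ends k
  -- The first gap gets the least admissible length; the second absorbs all remaining positions.
  r₁ = 6 * k + 2
  r₂ = 7 * k + 12 + s
  z  = e + r₁
  w  = z + e
  f  = w + r₂

  size : f + e ≡ n
  size = trans (id k s) n-size
    where
    id : ∀ k s → 2 * k + 1 + (6 * k + 2) + (2 * k + 1) + (7 * k + 12 + s) + (2 * k + 1) ≡ 19 * k + 17 + s
    id = solve-∀

  X : ℕ → Bool
  X x = if x <ᵇ e then not (k <ᵇ count (λ y → t y x) z (e + r₂ + e)) else
        if x <ᵇ z then false else
        if x <ᵇ w then true else
        if x <ᵇ f then false else not (k <ᵇ count (t x) 0 w)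

  X-first : ∀ x → x < e → X x ≡ not (k <ᵇ count (λ y → t y x) z (e + r₂ + e))
  X-first x p = if-true (<⇒<ᵇ-true p)

  gap₁ : ∀ x → e ≤ x → x < z → X x ≡ false
  gap₁ x p q = if-false (≥⇒<ᵇ-false p) (if-true (<⇒<ᵇ-true q))

  centre : ∀ x → z ≤ x → x < w → X x ≡ true
  centre x p q = if-false (≥⇒<ᵇ-false (≤-trans (m≤m+n e r₁) p)) (if-false (≥⇒<ᵇ-false p) (if-true (<⇒<ᵇ-true q)))

  gap₂ : ∀ x → w ≤ x → x < f → X x ≡ false
  gap₂ x p q = if-false (≥⇒<ᵇ-false (≤-trans (m≤m+n e r₁) (≤-trans (m≤m+n z e) p)))
    (if-false (≥⇒<ᵇ-false (≤-trans (m≤m+n z e) p)) (if-false (≥⇒<ᵇ-false p) (if-true (<⇒<ᵇ-true q))))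

  X-last : ∀ x → f ≤ x → X x ≡ not (k <ᵇ count (t x) 0 w)
  X-last x p = if-false (≥⇒<ᵇ-false (≤-trans (m≤m+n e r₁) (≤-trans (m≤m+n z e) (≤-trans (m≤m+n w r₂) p))))
    (if-false (≥⇒<ᵇ-false (≤-trans (m≤m+n z e) (≤-trans (m≤m+n w r₂) p)))
    (if-false (≥⇒<ᵇ-false (≤-trans (m≤m+n w r₂) p)) (if-false (≥⇒<ᵇ-false p) refl)))

  -- The last `4k + 1` positions lie in the range that `X` tests, so a good vertex of the first
  -- block passes the test; any other one lies in the first gap.
  goodA⇒clean : ∀ a → a < 3 * k + 1 → good-in M k c₀ a ≡ true → X a ≡ false
  goodA⇒clean a a< g with e ≤? a
  ... | yes p = gap₁ a p (<-≤-trans a< (linear (5 * k + 2) ≤-refl (id k)))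
    where
    id : ∀ k → 3 * k + 1 + 0 + (5 * k + 2) ≡ 2 * k + 1 + (6 * k + 2) + 0
    id = solve-∀
  ... | no p = trans (X-first a (≰⇒> p)) (cong not (<⇒<ᵇ-true
    (<-≤-trans (<ᵇ-true g) (count-inside (λ y → t y a) {z} {e + r₂ + e} {c₀} {4 * k + 1} z≤c₀ (≤-reflexive (trans c-size (sym total)))))))
    where
    total : z + (e + r₂ + e) ≡ n
    total = trans (id z e r₂) size
      where
      id : ∀ z e r₂ → z + (e + r₂ + e) ≡ z + e + r₂ + e
      id = solve-∀
    z≤c₀ : z ≤ c₀
    z≤c₀ = linear (7 * k + 13 + s) (≤-reflexive (trans n-size (sym c-size))) (id k s c₀)
      where
      id : ∀ k s c₀ → 2 * k + 1 + (6 * k + 2) + (c₀ + (4 * k + 1)) + (7 * k + 13 + s) ≡ c₀ + (19 * k + 17 + s)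
      id = solve-∀

  goodB⇒clean : ∀ b → b₀ ≤ b → b < n → good-out M k b ≡ true → X b ≡ false
  goodB⇒clean b b₀≤b b<n g with f ≤? b
  ... | no p = gap₂ b (≤-trans w≤b₀ b₀≤b) (≰⇒> p)
    where
    w≤b₀ : w ≤ b₀
    w≤b₀ = linear (6 * k + 12 + s) (≤-reflexive (trans n-size (sym b-size))) (id k s b₀)
      where
      id : ∀ k s b₀ → 2 * k + 1 + (6 * k + 2) + (2 * k + 1) + (b₀ + (3 * k + 1)) + (6 * k + 12 + s) ≡ b₀ + (19 * k + 17 + s)
      id = solve-∀
  ... | yes p = trans (X-last b p) (cong not (<⇒<ᵇ-true
    (<-≤-trans (<ᵇ-true g) (count-inside (t b) {0} {w} {0} {4 * k + 1} z≤n (linear (6 * k + 3) ≤-refl (id k))))))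
    where
    id : ∀ k → 4 * k + 1 + 0 + (6 * k + 3) ≡ 2 * k + 1 + (6 * k + 2) + (2 * k + 1) + 0
    id = solve-∀

  hubbed : Hubbed M X k r₁ r₂ b₀ c₀
  hubbed = record
    { size = size ; b-size = b-size ; c-size = c-size
    ; r₁≥ = ≤-refl
    ; r₂≥ = linear (k + 10 + s) ≤-refl (id₁ k s)
    ; n≥ = subst (17 * k + 6 ≤_) n-size (linear (2 * k + 11 + s) ≤-refl (id₂ k s))
    ; gap₁ = gap₁ ; centre = centre ; gap₂ = gap₂
    ; last-clean = λ b p b<n Xb → <ᵇ-true (not-false (trans (sym (X-last b p)) Xb))
    ; last-dirty = λ b p b<n Xb → ≤-trans (count-part′ (t b) 0 z e)
        (<ᵇ-false (not-true (trans (sym (X-last b p)) Xb)))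
    ; first-clean = λ a p Xa → <ᵇ-true (not-false (trans (sym (X-first a p)) Xa))
    ; first-dirty = λ a p Xa → ≤-trans
        (subst (λ l → count (λ y → t y a) z e ≤ count (λ y → t y a) z l) (sym (+-assoc e r₂ e)) (count-part (λ y → t y a) z e (r₂ + e)))
        (<ᵇ-false (not-true (trans (sym (X-first a p)) Xa)))
    ; goodA = good-in M k c₀ ; goodB = good-out M k ; manyA = manyA ; manyB = manyB
    ; goodA⇒ = λ a p g → goodA⇒clean a p g , <ᵇ-true g
    ; goodB⇒ = λ b p b<n g → goodB⇒clean b p b<n g , <ᵇ-true g
    }
    where
    id₁ : ∀ k s → 6 * k + 2 + 0 + (k + 10 + s) ≡ 7 * k + 12 + s + 0
    id₁ = solve-∀
    id₂ : ∀ k s → 17 * k + 6 + 0 + (2 * k + 11 + s) ≡ 19 * k + 17 + s + 0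
    id₂ = solve-∀

module Few-Good {n : ℕ} (M : MedianOrder n) (k s b₀ : ℕ)
  (n-size : 19 * k + 17 + s ≡ n) (b-size : b₀ + (3 * k + 1) ≡ n)
  (fewB : count (good-out M k) b₀ (3 * k + 1) ≤ k)
  where
  open MedianOrder M

  α β γ : ℕ
  α = 4 * k + 1
  β = 3 * k + 1
  γ = 12 * k + 15 + s

  α+γ : α + γ ≡ b₀
  α+γ = +-cancelʳ-≡ β (α + γ) b₀ (trans (id k s) (trans n-size (sym b-size)))
    where
    id : ∀ k s → 4 * k + 1 + (12 * k + 15 + s) + (3 * k + 1) ≡ 19 * k + 17 + s
    id = solve-∀

  bad : ℕ → Bool
  bad b = not (good-out M k b)

  to-bad : ℕ → ℕ
  to-bad a = count (λ y → bad y ∧ t a y) b₀ β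

  chosen rejected : ℕ → Bool
  chosen a   = k <ᵇ to-bad a
  rejected a = not (chosen a)

  X : ℕ → Bool
  X x = if x <ᵇ α then chosen x else if x <ᵇ b₀ then false else bad x

  X-low : ∀ x → x < α → X x ≡ chosen x
  X-low x p = if-true (<⇒<ᵇ-true p)

  X-middle : ∀ x → α ≤ x → x < b₀ → X x ≡ false
  X-middle x p q = if-false (≥⇒<ᵇ-false p) (if-true (<⇒<ᵇ-true q))

  α≤b₀ : α ≤ b₀
  α≤b₀ = subst (α ≤_) α+γ (m≤m+n α γ)

  X-high : ∀ x → b₀ ≤ x → X x ≡ bad x
  X-high x p = if-false (≥⇒<ᵇ-false (≤-trans α≤b₀ p)) (if-false (≥⇒<ᵇ-false p) refl)

  b₀+β≤n : b₀ + β ≤ n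
  b₀+β≤n = ≤-reflexive b-size

  α≤n : α ≤ n
  α≤n = ≤-trans α≤b₀ (subst (b₀ ≤_) b-size (m≤m+n b₀ β))

  either : ∀ a b → a < α → b₀ ≤ b → b < n → t a b ≡ true ⊎ t b a ≡ true
  either a b a<α b₀≤b b<n with t a b in tab
  ... | true  = inj₁ refl
  ... | false = inj₂ (trans (anti a b (<-≤-trans a<α α≤n) b<n (<⇒≢ (<-≤-trans a<α (≤-trans α≤b₀ b₀≤b)))) (cong not tab))

  many-bad : 2 * k + 1 ≤ count bad b₀ β
  many-bad = linear 0
    (length-cover₂ (good-out M k) bad b₀ β (λ x _ _ → true-or-not (good-out M k x)) ⊕ fewB)
    (id k (count (good-out M k) b₀ β) (count bad b₀ β))
    where
    id : ∀ k g b → 2 * k + 1 + (g + b + k) + 0 ≡ b + (3 * k + 1 + g)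
    id = solve-∀

  bad-out : ∀ b → bad b ≡ true → count (t b) 0 α ≤ k
  bad-out b h = <ᵇ-false (not-true h)

  arcs : ℕ → ℕ → Bool
  arcs a b = rejected a ∧ (bad b ∧ t b a)

  -- A rejected position dominates at most `k` bad ones, so all but `k` of the bad ones dominate it.
  -- The factor `𝟙 (rejected a)` makes the bound summable over all first positions.
  rejected-row : ∀ a → a < α → 𝟙 (rejected a) * count bad b₀ β ≤ count (arcs a) b₀ β + 𝟙 (rejected a) * k
  rejected-row a a<α with k <ᵇ to-bad a in eq
  ... | true  = z≤n
  ... | false = linear 0
    (count-cover₂ bad (λ b → bad b ∧ t a b) (λ b → bad b ∧ t b a) b₀ β split ⊕ <ᵇ-false eq)
    (id k (count bad b₀ β) (to-bad a) (count (λ b → bad b ∧ t b a) b₀ β))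
    where
    id : ∀ k b o i → b + 0 + (o + i + k) + 0 ≡ i + (k + 0) + (b + o)
    id = solve-∀
    split : ∀ b → b₀ ≤ b → b < b₀ + β → bad b ≡ true → bad b ∧ t a b ≡ true ⊎ bad b ∧ t b a ≡ true
    split b p q h with either a b a<α p (<-≤-trans q b₀+β≤n)
    ... | inj₁ x = inj₁ (∧-true h x)
    ... | inj₂ x = inj₂ (∧-true h x)

  bad-column : ∀ b → count (λ a → arcs a b) 0 α ≤ 𝟙 (bad b) * k
  bad-column b with bad b in eq
  ... | false = count-none (λ a → rejected a ∧ false) 0 α (λ a _ _ → ∧-zeroʳ (rejected a))
  ... | true  = ≤-trans (count-mono (λ a → rejected a ∧ t b a) (t b) 0 α (λ a _ _ h → ∧-trueʳ (rejected a) h))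
    (≤-trans (bad-out b eq) (≤-reflexive (sym (+-identityʳ k))))

  -- Arcs from bad to rejected positions are counted by rows and by columns: for `p` rejected and
  -- `m` bad positions there are at least `p (m - k)` and at most `m k`.
  double-count : count rejected 0 α * count bad b₀ β ≤ count bad b₀ β * k + count rejected 0 α * k
  double-count = begin
    count rejected 0 α * m                           ≡⟨ sym (sum-*ʳ (𝟙 ∘ rejected) m 0 α) ⟩
    sumFrom (λ a → 𝟙 (rejected a) * m) 0 α            ≤⟨ sum-mono _ _ 0 α (λ a _ a<α → rejected-row a a<α) ⟩
    sumFrom (λ a → count (arcs a) b₀ β + 𝟙 (rejected a) * k) 0 α
                                                     ≡⟨ sum-+ (λ a → count (arcs a) b₀ β) (λ a → 𝟙 (rejected a) * k) 0 α ⟩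
    sumFrom (λ a → count (arcs a) b₀ β) 0 α + sumFrom (λ a → 𝟙 (rejected a) * k) 0 α
                                                     ≡⟨ cong₂ _+_ (sum-swap (λ a b → 𝟙 (arcs a b)) 0 α b₀ β) (sum-*ʳ (𝟙 ∘ rejected) k 0 α) ⟩
    sumFrom (λ b → count (λ a → arcs a b) 0 α) b₀ β + count rejected 0 α * k
                                                     ≤⟨ +-monoˡ-≤ _ (sum-mono _ _ b₀ β (λ b _ _ → bad-column b)) ⟩
    sumFrom (λ b → 𝟙 (bad b) * k) b₀ β + count rejected 0 α * k
                                                     ≡⟨ cong (_+ count rejected 0 α * k) (sum-*ʳ (𝟙 ∘ bad) k b₀ β) ⟩
    m * k + count rejected 0 α * k                   ∎
    where
    open ≤-Reasoning
    m : ℕ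
    m = count bad b₀ β

  -- The double count amounts to `(p - k) (m - k) ≤ k * k`, which fails when `p` and `m` are both at
  -- least `2k + 1`.
  few-rejected : count rejected 0 α ≤ 2 * k
  few-rejected with 2 * k + 1 ≤? count rejected 0 α
  ... | no p = ≤-pred (subst (suc (count rejected 0 α) ≤_) (+-comm (2 * k) 1) (≰⇒> p))
  ... | yes p with m≤n⇒∃[o]m+o≡n p | m≤n⇒∃[o]m+o≡n many-bad
  ...   | x , ex | y , ey = ⊥-elim (linear-⊥ (2 * k + (k + 1) * (x + y) + x * y)
    (subst₂ (λ p m → p * m ≤ m * k + p * k) (sym ex) (sym ey) double-count) (id k x y))
    where
    id : ∀ k x y → suc ((2 * k + 1 + y) * k + (2 * k + 1 + x) * k) + (2 * k + (k + 1) * (x + y) + x * y) ≡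
      (2 * k + 1 + x) * (2 * k + 1 + y)
    id = solve-∀

  many-chosen : 2 * k + 1 ≤ count chosen 0 α
  many-chosen = linear 0
    (length-cover₂ chosen rejected 0 α (λ x _ _ → true-or-not (chosen x)) ⊕ few-rejected)
    (id k (count chosen 0 α) (count rejected 0 α))
    where
    id : ∀ k c r → 2 * k + 1 + (c + r + 2 * k) + 0 ≡ c + (4 * k + 1 + r)
    id = solve-∀

  -- A good `b` is clean and keeps its arcs. A bad `b` dominates at most `k` of the at least
  -- `2k + 1` chosen positions, so more than `k` of them dominate it, and these arcs are turned.
  back : ∀ b → b₀ ≤ b → b < n → k < count (flip t X b) 0 α
  back b p b<n = by-good (good-out M k b) refl
    where
    split : ∀ a → 0 ≤ a → a < α → chosen a ≡ true → chosen a ∧ t a b ≡ true ⊎ t b a ≡ true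
    split a _ a<α h with either a b a<α p b<n
    ... | inj₁ x = inj₁ (∧-true h x)
    ... | inj₂ x = inj₂ x
    id : ∀ k c d o f → suc k + (c + (d + o) + k + f) + 0 ≡ f + (2 * k + 1 + c + o + d)
    id = solve-∀
    by-good : ∀ g → good-out M k b ≡ g → k < count (flip t X b) 0 α
    by-good true  eq = <-≤-trans (<ᵇ-true eq) (count-mono (t b) (flip t X b) 0 α
      (λ a _ _ h → trans (flip-cleanˡ t X b a (trans (X-high b p) (cong not eq))) h))
    by-good false eq = linear 0
      (many-chosen ⊕ count-cover₂ chosen (λ a → chosen a ∧ t a b) (t b) 0 α split
        ⊕ bad-out b (cong not eq)
        ⊕ count-mono (λ a → chosen a ∧ t a b) (flip t X b) 0 α
            (λ a _ a<α h → trans (flip-dirty t X b a (trans (X-high b p) (cong not eq))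
              (trans (X-low a a<α) (∧-trueˡ (chosen a) h))) (∧-trueʳ (chosen a) h)))
      (id k (count chosen 0 α) (count (λ a → chosen a ∧ t a b) 0 α) (count (t b) 0 α) (count (flip t X b) 0 α))

  -- A chosen `a` dominates more than `k` bad positions, and these arcs are turned. A rejected `a`
  -- is clean and is dominated by more than `k` of the at least `2k + 1` bad ones.
  forth : ∀ a → a < α → k < count (λ x → flip t X x a) b₀ β
  forth a a<α = by-chosen (chosen a) refl
    where
    split : ∀ y → b₀ ≤ y → y < b₀ + β → bad y ≡ true → bad y ∧ t a y ≡ true ⊎ t y a ≡ true
    split y p q h with either a y a<α p (<-≤-trans q b₀+β≤n)
    ... | inj₁ x = inj₁ (∧-true h x)
    ... | inj₂ x = inj₂ x
    id : ∀ k c d o f → suc k + (c + (d + o) + k + f) + 0 ≡ f + (2 * k + 1 + c + d + o)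
    id = solve-∀
    by-chosen : ∀ c → chosen a ≡ c → k < count (λ x → flip t X x a) b₀ β
    by-chosen true  eq = <-≤-trans (<ᵇ-true eq) (count-mono (λ y → bad y ∧ t a y) (λ x → flip t X x a) b₀ β
      (λ y p _ h → trans (flip-dirty t X y a (trans (X-high y p) (∧-trueˡ (bad y) h)) (trans (X-low a a<α) eq)) (∧-trueʳ (bad y) h)))
    by-chosen false eq = linear 0
      (many-bad ⊕ count-cover₂ bad (λ y → bad y ∧ t a y) (λ y → t y a) b₀ β split
        ⊕ <ᵇ-false eq
        ⊕ count-mono (λ y → t y a) (λ x → flip t X x a) b₀ β
            (λ y _ _ h → trans (flip-cleanʳ t X y a (trans (X-low a a<α) eq)) h))
      (id k (count bad b₀ β) (to-bad a) (count (λ y → t y a) b₀ β) (count (λ x → flip t X x a) b₀ β))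

  linked : Linked M X k α γ β
  linked = record
    { size = trans (cong (_+ β) α+γ) b-size
    ; α≥ = linear (2 * k) ≤-refl (id₁ k)
    ; α≤ = ≤-refl
    ; β≥ = linear k ≤-refl (id₂ k)
    ; β≤ = linear k ≤-refl (id₃ k)
    ; γ≥ = linear (k + 14 + s) ≤-refl (id₄ k s)
    ; middle = λ x p q → X-middle x p (subst (x <_) α+γ q)
    ; back = λ b p → back b (subst (_≤ b) α+γ p)
    ; forth = λ a p → subst (λ y → k < count (λ x → flip t X x a) y β) (sym α+γ) (forth a p)
    }
    where
    id₁ : ∀ k → 2 * k + 1 + 0 + 2 * k ≡ 4 * k + 1 + 0
    id₁ = solve-∀
    id₂ : ∀ k → 2 * k + 1 + 0 + k ≡ 3 * k + 1 + 0
    id₂ = solve-∀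
    id₃ : ∀ k → 3 * k + 1 + 0 + k ≡ 4 * k + 1 + 0
    id₃ = solve-∀
    id₄ : ∀ k s → 11 * k + 1 + 0 + (k + 14 + s) ≡ 12 * k + 15 + s + 0
    id₄ = solve-∀

flip-cong : ∀ t X Y i j → X i ≡ Y i → X j ≡ Y j → flip t X i j ≡ flip t Y i j
flip-cong t X Y i j p q rewrite p | q = refl

-- Mirroring twice restores a set only at positions below `n`, so a cut for the doubly mirrored set
-- has to be carried over to the original one.
cut-cong : ∀ {n k X Y} {M : MedianOrder n} → (∀ i → i < n → X i ≡ Y i) → Cut M X k → Cut M Y k
cut-cong {X = X} {Y} {M} X≡Y C = record
  { Q = Q ; N = N ; S = S ; some = some ; Q∩N = Q∩N ; few = few
  ; closed = λ i j i<n j<n q r → trans (sym (flip-cong t X Y i j (X≡Y i i<n) (X≡Y j j<n))) (closed i j i<n j<n q r)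
  }
  where
  open Cut C
  open MedianOrder M

inversion-exists : ∀ {n} (M : MedianOrder n) k → 19 * k + 17 ≤ n → ∃ λ X → NoCut M X k
inversion-exists {n} M k n≥ with m≤n⇒∃[o]m+o≡n n≥
... | s , n-size = choose (k <? count (good-in M k c₀) 0 (3 * k + 1)) (k <? count (good-out M k) b₀ (3 * k + 1))
  where
  open MedianOrder M
  b₀ c₀ : ℕ
  b₀ = 16 * k + 16 + s
  c₀ = 15 * k + 16 + s
  b-size : b₀ + (3 * k + 1) ≡ n
  b-size = trans (id k s) n-size
    where
    id : ∀ k s → 16 * k + 16 + s + (3 * k + 1) ≡ 19 * k + 17 + s
    id = solve-∀
  c-size : c₀ + (4 * k + 1) ≡ n
  c-size = trans (id k s) n-size
    where
    id : ∀ k s → 15 * k + 16 + s + (4 * k + 1) ≡ 19 * k + 17 + s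
    id = solve-∀
  choose : Dec (k < count (good-in M k c₀) 0 (3 * k + 1)) → Dec (k < count (good-out M k) b₀ (3 * k + 1)) →
    ∃ λ X → NoCut M X k
  choose (yes p) (yes q) = _ , hubbed⇒no-cut (Balanced-Ends.hubbed M k s b₀ c₀ n-size b-size c-size p q)
  choose _ (no q) = _ , linked⇒no-cut (Few-Good.linked M k s b₀ n-size b-size (≮⇒≥ q))
  -- Few good vertices at the beginning are few good ones at the end of the reversed order; the set
  -- found there is mirrored back.
  choose (no p) _ = Y ∘ mirror n , λ C i j i<n j<n Qi Nj →
    linked⇒no-cut (Few-Good.linked (reverseOrder M) k s b₀ n-size b-size fewB)
      (cut-cong (λ x x<n → cong Y (mirror-involutive x<n)) (reverseCut C))
      (mirror n j) (mirror n i) (mirror-< j<n) (mirror-< i<n)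
      (trans (cong (Cut.N C) (mirror-involutive j<n)) Nj)
      (trans (cong (Cut.Q C) (mirror-involutive i<n)) Qi)
    where
    same : ∀ b → good-out (reverseOrder M) k b ≡ good-in M k c₀ (mirror n b)
    same b = cong (k <ᵇ_) (count-mirror (λ y → t y (mirror n b)) n 0 (4 * k + 1) c₀
      (trans (+-comm (4 * k + 1) c₀) c-size))
    fewB : count (good-out (reverseOrder M) k) b₀ (3 * k + 1) ≤ k
    fewB = subst (_≤ k) (sym (trans (count-cong _ _ b₀ (3 * k + 1) same)
      (count-mirror (good-in M k c₀) n b₀ (3 * k + 1) 0 (trans (+-identityʳ _) b-size)))) (≮⇒≥ p)
    Y : ℕ → Bool
    Y = Few-Good.X (reverseOrder M) k s b₀ n-size b-size fewB

-- Existence of median orders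

listSum : {A : Set} → (A → ℕ) → List A → ℕ
listSum g []       = 0
listSum g (x ∷ xs) = g x + listSum g xs

listSum-++ : ∀ {A : Set} (g : A → ℕ) xs ys → listSum g (xs ++ ys) ≡ listSum g xs + listSum g ys
listSum-++ g []       ys = refl
listSum-++ g (x ∷ xs) ys = trans (cong (g x +_) (listSum-++ g xs ys)) (sym (+-assoc (g x) _ _))

listSum-↭ : ∀ {A : Set} (g : A → ℕ) {xs ys} → xs ↭ ys → listSum g xs ≡ listSum g ys
listSum-↭ g Perm.refl          = refl
listSum-↭ g (Perm.prep x p)    = cong (g x +_) (listSum-↭ g p)
listSum-↭ g (Perm.swap x y p)  = trans (cong (λ s → g x + (g y + s)) (listSum-↭ g p)) (id (g x) (g y) _)
  where
  id : ∀ a b c → a + (b + c) ≡ b + (a + c)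
  id = solve-∀
listSum-↭ g (Perm.trans p q)   = trans (listSum-↭ g p) (listSum-↭ g q)

listSum-𝟙≤ : ∀ {A : Set} (f : A → Bool) xs → listSum (𝟙 ∘ f) xs ≤ length xs
listSum-𝟙≤ f []       = z≤n
listSum-𝟙≤ f (x ∷ xs) with f x
... | true  = s≤s (listSum-𝟙≤ f xs)
... | false = m≤n⇒m≤1+n (listSum-𝟙≤ f xs)

-- The default d only serves to make nth total.
nth : {A : Set} → A → List A → ℕ → A
nth d []       i       = d
nth d (x ∷ xs) zero    = x
nth d (x ∷ xs) (suc i) = nth d xs i

nth-++ : ∀ {A : Set} (d : A) p ys j → nth d (p ++ ys) (length p + j) ≡ nth d ys j
nth-++ d []      ys j = refl
nth-++ d (x ∷ p) ys j = nth-++ d p ys j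

sum-shift : ∀ w i l → sumFrom w (suc i) l ≡ sumFrom (w ∘ suc) i l
sum-shift w i zero    = refl
sum-shift w i (suc l) = cong (w (suc i) +_) (sum-shift w (suc i) l)

sum-nth : ∀ {A : Set} (d : A) (g : A → ℕ) p m s →
  sumFrom (g ∘ nth d (p ++ (m ++ s))) (length p) (length m) ≡ listSum g m
sum-nth d g []      []      s = refl
sum-nth d g []      (x ∷ m) s = cong (g x +_) (trans (sum-shift (g ∘ nth d (x ∷ m ++ s)) 0 (length m)) (sum-nth d g [] m s))
sum-nth d g (x ∷ p) m       s = trans (sum-shift (g ∘ nth d (x ∷ p ++ (m ++ s))) (length p) (length m)) (sum-nth d g p m s)

sum-nth′ : ∀ {A : Set} (d : A) (g : A → ℕ) p v m s →
  sumFrom (g ∘ nth d (p ++ v ∷ (m ++ s))) (suc (length p)) (length m) ≡ listSum g m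
sum-nth′ d g []      v m s = trans (sum-shift (g ∘ nth d (v ∷ m ++ s)) 0 (length m)) (sum-nth d g [] m s)
sum-nth′ d g (x ∷ p) v m s = trans (sum-shift (g ∘ nth d (x ∷ p ++ v ∷ (m ++ s))) (suc (length p)) (length m)) (sum-nth′ d g p v m s)

nth-mid : ∀ {A : Set} (d : A) p v s → nth d (p ++ v ∷ s) (length p) ≡ v
nth-mid d []      v s = refl
nth-mid d (x ∷ p) v s = nth-mid d p v s

split-at : ∀ {A : Set} (xs : List A) i → i ≤ length xs → ∃₂ λ p s → xs ≡ p ++ s × length p ≡ i
split-at xs       zero    h       = [] , xs , refl , refl
split-at (x ∷ xs) (suc i) (s≤s h) = let p , s , e , l = split-at xs i h in x ∷ p , s , cong (x ∷_) e , cong suc l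

split-right : ∀ {A : Set} (xs : List A) i l → suc i + l ≤ length xs →
  ∃₂ λ p v → ∃₂ λ m s → xs ≡ p ++ v ∷ (m ++ s) × length p ≡ i × length m ≡ l
split-right (x ∷ xs) zero l (s≤s h) with split-at xs l h
... | m , s , refl , e = [] , x , m , s , refl , refl , e
split-right (x ∷ xs) (suc i) l (s≤s h) with split-right xs i l h
... | p , v , m , s , refl , e , e′ = x ∷ p , v , m , s , refl , cong suc e , e′

split-left : ∀ {A : Set} (xs : List A) i l → suc i + l ≤ length xs →
  ∃₂ λ p v → ∃₂ λ m s → xs ≡ p ++ (m ++ v ∷ s) × length p ≡ i × length m ≡ l
split-left xs i l h with split-at xs i (≤-trans (≤-trans (n≤1+n i) (m≤m+n (suc i) l)) h)
... | p , s , refl , refl with split-at s l (≤-trans (n≤1+n l) long)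
  where
  long : suc l ≤ length s
  long = +-cancelˡ-≤ (length p) _ _ (subst₂ _≤_ (sym (+-suc (length p) l)) (length-++ p) h)
... | m , v ∷ s′ , refl , refl = p , v , m , s′ , refl , refl , refl
... | m , [] , refl , refl = ⊥-elim (1+n≰n (≤-trans h (≤-reflexive len)))
  where
  len : length (p ++ (m ++ [])) ≡ length p + length m
  len = trans (length-++ p) (cong (length p +_) (trans (length-++ m) (+-identityʳ _)))

module Median {n : ℕ} (D : Digraph n) where

  a : Fin n → Fin n → ℕ
  a u v = 𝟙 (arc D u v)

  forward : List (Fin n) → ℕ
  forward []       = 0
  forward (x ∷ xs) = listSum (a x) xs + forward xs

  forward≤ : ∀ xs → forward xs ≤ length xs * length xs
  forward≤ []       = z≤n
  forward≤ (x ∷ xs) = linear (1 + length xs) (listSum-𝟙≤ (arc D x) xs ⊕ forward≤ xs)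
    (id (listSum (a x) xs) (forward xs) (length xs))
    where
    id : ∀ s f l → s + f + (l + l * l) + (1 + l) ≡ suc l * suc l + (s + f)
    id = solve-∀

  -- Moving `v` across `m` affects only the arcs between `v` and `m`.
  forward-shift : ∀ m v s → forward (m ++ v ∷ s) + listSum (a v) m ≡ forward (v ∷ m ++ s) + listSum (λ x → a x v) m
  forward-shift []      v s = refl
  forward-shift (x ∷ m) v s = trans
    (cong (λ y → y + forward (m ++ v ∷ s) + (a v x + listSum (a v) m)) outs-x)
    (trans (id₁ (a x v) (listSum (a x) (m ++ s)) (forward (m ++ v ∷ s)) (a v x) (listSum (a v) m))
    (trans (cong (λ y → a x v + listSum (a x) (m ++ s) + a v x + y) (forward-shift m v s))
    (id₂ (a x v) (listSum (a x) (m ++ s)) (a v x) (listSum (a v) (m ++ s)) (forward (m ++ s)) (listSum (λ x → a x v) m))))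
    where
    outs-x : listSum (a x) (m ++ v ∷ s) ≡ a x v + listSum (a x) (m ++ s)
    outs-x = listSum-↭ (a x) (shift v m s)
    id₁ : ∀ p q r s t → p + q + r + (s + t) ≡ p + q + s + (r + t)
    id₁ = solve-∀
    id₂ : ∀ p q r s t u → p + q + r + (s + t + u) ≡ r + s + (q + t) + (p + u)
    id₂ = solve-∀

  forward-++-< : ∀ p {ys zs} → ys ↭ zs → forward ys < forward zs → forward (p ++ ys) < forward (p ++ zs)
  forward-++-< []      σ h = h
  forward-++-< (x ∷ p) σ h = +-mono-≤-< (≤-reflexive (listSum-↭ (a x) (++⁺ˡ p σ))) (forward-++-< p σ h)

  Improvable : List (Fin n) → Set
  Improvable xs = ∃ λ ys → ys ↭ xs × forward xs < forward ys

  move-right : ∀ p v m s → listSum (a v) m < listSum (λ x → a x v) m → Improvable (p ++ v ∷ (m ++ s))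
  move-right p v m s h = p ++ (m ++ v ∷ s) , ++⁺ˡ p (shift v m s) ,
    forward-++-< p (↭-sym (shift v m s)) (linear 0 (h ⊕ ≤-reflexive (sym (forward-shift m v s)))
      (id (forward (v ∷ m ++ s)) (forward (m ++ v ∷ s)) (listSum (a v) m) (listSum (λ x → a x v) m)))
    where
    id : ∀ f g o i → suc f + (i + (g + o)) + 0 ≡ g + (suc o + (f + i))
    id = solve-∀

  move-left : ∀ p m v s → listSum (λ x → a x v) m < listSum (a v) m → Improvable (p ++ (m ++ v ∷ s))
  move-left p m v s h = p ++ v ∷ (m ++ s) , ++⁺ˡ p (↭-sym (shift v m s)) ,
    forward-++-< p (shift v m s) (linear 0 (h ⊕ ≤-reflexive (forward-shift m v s))
      (id (forward (v ∷ m ++ s)) (forward (m ++ v ∷ s)) (listSum (a v) m) (listSum (λ x → a x v) m)))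
    where
    id : ∀ f g o i → suc g + (o + (f + i)) + 0 ≡ f + (suc i + (g + o))
    id = solve-∀

  module _ (d : Fin n) where

    outR inR outL inL : List (Fin n) → ℕ → ℕ → ℕ
    outR xs i l = count (λ x → arc D (nth d xs i) (nth d xs x)) (suc i) l
    inR  xs i l = count (λ x → arc D (nth d xs x) (nth d xs i)) (suc i) l
    outL xs i l = count (λ x → arc D (nth d xs (i + l)) (nth d xs x)) i l
    inL  xs i l = count (λ x → arc D (nth d xs x) (nth d xs (i + l))) i l

    -- Moving one vertex across the interval just after or just before it would gain forward arcs.
    Violation : List (Fin n) → ℕ → ℕ → Set
    Violation xs i l = suc i + l ≤ length xs × (outR xs i l < inR xs i l ⊎ inL xs i l < outL xs i l)

    improve : ∀ xs i l → Violation xs i l → Improvable xs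
    improve xs i l (h , inj₁ lt) with split-right xs i l h
    ... | p , v , m , s , refl , refl , refl = move-right p v m s
      (subst₂ _<_ (eq (arc D)) (eq (λ u y → arc D y u)) lt)
      where
      ys : List (Fin n)
      ys = p ++ v ∷ (m ++ s)
      eq : ∀ (r : Fin n → Fin n → Bool) →
        count (λ x → r (nth d ys (length p)) (nth d ys x)) (suc (length p)) (length m) ≡ listSum (𝟙 ∘ r v) m
      eq r rewrite nth-mid d p v (m ++ s) = sum-nth′ d (𝟙 ∘ r v) p v m s
    improve xs i l (h , inj₂ lt) with split-left xs i l h
    ... | p , v , m , s , refl , refl , refl = move-left p m v s
      (subst₂ _<_ (eq (λ u y → arc D y u)) (eq (arc D)) lt)
      where
      ys : List (Fin n)
      ys = p ++ (m ++ v ∷ s)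
      eq : ∀ (r : Fin n → Fin n → Bool) →
        count (λ x → r (nth d ys (length p + length m)) (nth d ys x)) (length p) (length m) ≡ listSum (𝟙 ∘ r v) m
      eq r rewrite nth-++ d p (m ++ v ∷ s) (length m) | nth-mid d m v s = sum-nth d (𝟙 ∘ r v) p m (v ∷ s)

    violation? : ∀ xs i l → Dec (Violation xs i l)
    violation? xs i l = suc i + l ≤? length xs ×-dec
      (outR xs i l <? inR xs i l ⊎-dec inL xs i l <? outL xs i l)

    any-violation? : ∀ xs → Dec (∃ λ i → i < length xs × ∃ λ l → l < length xs × Violation xs i l)
    any-violation? xs = anyUpTo? (λ i → anyUpTo? (violation? xs i) (length xs)) (length xs)

    -- The inequalities of `MedianOrder` concern single moves, so a local optimum provides them. The
    -- search ends because `forward` grows with each move and is at most the square of the length.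
    stable : ∀ xs → ∃ λ ys → ys ↭ xs × (∀ i l → ¬ Violation ys i l)
    stable xs = <-rec P step (length xs * length xs ∸ forward xs) xs refl
      where
      P : ℕ → Set
      P g = ∀ xs → length xs * length xs ∸ forward xs ≡ g → ∃ λ ys → ys ↭ xs × (∀ i l → ¬ Violation ys i l)
      step : ∀ g → (∀ {h} → h < g → P h) → P g
      step g rec xs refl with any-violation? xs
      ... | no none = xs , ↭-refl , λ i l V → none (i ,
        ≤-trans (m≤m+n (suc i) l) (proj₁ V) , l , ≤-trans (s≤s (m≤n+m l i)) (proj₁ V) , V)
      ... | yes (i , _ , l , _ , V) with improve xs i l V
      ...   | ys , σ , better with rec less ys refl
        where
        less : length ys * length ys ∸ forward ys < length xs * length xs ∸ forward xs
        less rewrite ↭-length σ = ∸-monoʳ-< better (subst (λ k → forward ys ≤ k * k) (↭-length σ) (forward≤ ys))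
      ...     | zs , τ , none = zs , ↭-trans τ σ , none

-- Positions and vertices of a tournament

nth-∈ : ∀ {A : Set} (d : A) {x xs} → x ∈ xs → ∃ λ i → i < length xs × nth d xs i ≡ x
nth-∈ d (here refl) = 0 , s≤s z≤n , refl
nth-∈ d (there p)   = let i , q , e = nth-∈ d p in suc i , s≤s q , e

nth-All : ∀ {A : Set} {P : A → Set} (d : A) {xs} i → All P xs → i < length xs → P (nth d xs i)
nth-All d zero    (px All.∷ _)  _       = px
nth-All d (suc i) (_ All.∷ pxs) (s≤s h) = nth-All d i pxs h

nth-injective : ∀ {A : Set} (d : A) {xs} → Unique xs → ∀ i j → i < length xs → j < length xs →
  nth d xs i ≡ nth d xs j → i ≡ j
nth-injective d (px ∷ u) zero    zero    p q e = refl
nth-injective d (px ∷ u) zero    (suc j) p (s≤s q) e = ⊥-elim (nth-All d j px q e)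
nth-injective d (px ∷ u) (suc i) zero    (s≤s p) q e = ⊥-elim (nth-All d i px p (sym e))
nth-injective d (px ∷ u) (suc i) (suc j) (s≤s p) (s≤s q) e = cong suc (nth-injective d u i j p q e)

listSum-tabulate : ∀ {n} {A : Set} (g : A → ℕ) (S : Subset n) (h : Fin n → A) →
  (∀ i → g (h i) ≡ 𝟙 (Vec.lookup S i)) → listSum g (tabulate h) ≡ ∣ S ∣
listSum-tabulate g Vec.[]          h e = refl
listSum-tabulate g (true Vec.∷ S)  h e = cong₂ _+_ (e Fin.zero) (listSum-tabulate g S (h ∘ Fin.suc) (e ∘ Fin.suc))
listSum-tabulate g (false Vec.∷ S) h e = cong₂ _+_ (e Fin.zero) (listSum-tabulate g S (h ∘ Fin.suc) (e ∘ Fin.suc))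

record Arrangement {n : ℕ} (D : Digraph n) : Set where
  field
    order  : MedianOrder n
    vertex : ℕ → Fin n
    place  : Fin n → ℕ
  open MedianOrder order public
  field
    t-arc        : ∀ i j → t i j ≡ arc D (vertex i) (vertex j)
    place<       : ∀ u → place u < n
    vertex-place : ∀ u → vertex (place u) ≡ u
    place-vertex : ∀ i → i < n → place (vertex i) ≡ i
    count-subset : ∀ (S : Subset n) → count (Vec.lookup S ∘ vertex) 0 n ≡ ∣ S ∣

-- The given vertex is the default of `nth`. In a tournament the in- and out-neighbours of a
-- position cover every interval beside it, so the absence of violations gives `outs` and `ins`.
arrangement : ∀ {n} (D : Digraph n) → IsTournament D → Fin n → Arrangement D
arrangement {n} D tour d with Median.stable D d (allFin n)
... | xs , σ , none = record
  { order = record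
    { t    = t
    ; anti = λ i j i<n j<n i≢j → tour (v i) (v j) (λ e → i≢j (injective i j i<n j<n e))
    ; outs = outs
    ; ins  = ins
    }
  ; vertex = v
  ; place = proj₁ ∘ at
  ; t-arc = λ i j → refl
  ; place< = λ u → subst (proj₁ (at u) <_) len (proj₁ (proj₂ (at u)))
  ; vertex-place = λ u → proj₂ (proj₂ (at u))
  ; place-vertex = λ i i<n → injective (proj₁ (at (v i))) i (subst (proj₁ (at (v i)) <_) len (proj₁ (proj₂ (at (v i))))) i<n
      (proj₂ (proj₂ (at (v i))))
  ; count-subset = λ S → trans (trans (cong (count (Vec.lookup S ∘ v) 0) (sym len)) (whole S))
      (trans (listSum-↭ (𝟙 ∘ Vec.lookup S) σ) (listSum-tabulate (𝟙 ∘ Vec.lookup S) S Function.id (λ _ → refl)))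
  }
  where
  v : ℕ → Fin n
  v = nth d xs
  t : ℕ → ℕ → Bool
  t i j = arc D (v i) (v j)
  len : length xs ≡ n
  len = trans (↭-length σ) (length-tabulate Function.id)
  at : ∀ u → ∃ λ i → i < length xs × v i ≡ u
  at u = nth-∈ d (∈-resp-↭ (↭-sym σ) (∈-allFin u))
  unique : Unique xs
  unique = Unique-resp-↭ (≡-setoid (Fin n)) (↭⇒↭ₛ (↭-sym σ)) (allFin⁺ n)
  injective : ∀ i j → i < n → j < n → v i ≡ v j → i ≡ j
  injective i j p q = nth-injective d unique i j (subst (i <_) (sym len) p) (subst (j <_) (sym len) q)
  whole : ∀ S → count (Vec.lookup S ∘ v) 0 (length xs) ≡ listSum (𝟙 ∘ Vec.lookup S) xs
  whole S = subst (λ ys → count (Vec.lookup S ∘ nth d ys) 0 (length xs) ≡ listSum (𝟙 ∘ Vec.lookup S) xs)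
    (++-identityʳ xs) (sum-nth d (𝟙 ∘ Vec.lookup S) [] xs [])
  either : ∀ i j → i < n → j < n → i ≢ j → t i j ≡ true ⊎ t j i ≡ true
  either i j p q i≢j with t i j in eq
  ... | true  = inj₁ refl
  ... | false = inj₂ (trans (tour (v i) (v j) (λ e → i≢j (injective i j p q e))) (cong not eq))
  outs : ∀ i l → suc i + l ≤ n → l ≤ 2 * count (t i) (suc i) l
  outs i l h = linear 0
    (length-cover₂ (t i) (λ x → t x i) (suc i) l
      (λ x p q → either i x (≤-trans (m≤m+n (suc i) l) h) (<-≤-trans q h) (<⇒≢ p))
     ⊕ ≮⇒≥ (λ lt → none i l (subst (suc i + l ≤_) (sym len) h , inj₁ lt)))
    (id l (count (t i) (suc i) l) (count (λ x → t x i) (suc i) l))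
    where
    id : ∀ l o i → l + (o + i + o) + 0 ≡ 2 * o + (l + i)
    id = solve-∀
  ins : ∀ i l → suc i + l ≤ n → l ≤ 2 * count (λ x → t x (i + l)) i l
  ins i l h = linear 0
    (length-cover₂ (λ x → t x (i + l)) (t (i + l)) i l
      (λ x p q → either x (i + l) (<-trans q h) h (<⇒≢ q))
     ⊕ ≮⇒≥ (λ lt → none i l (subst (suc i + l ≤_) (sym len) h , inj₂ lt)))
    (id l (count (λ x → t x (i + l)) i l) (count (t (i + l)) i l))
    where
    id : ∀ l o i → l + (o + i + o) + 0 ≡ 2 * o + (l + i)
    id = solve-∀

-- Strong connectivity through separating sets

-- A certificate that deleting `S` destroys strong connectivity. Unlike the absence of a path, it
-- can be decided by running through the subsets.
record Separates {n : ℕ} (D : Digraph n) (S Q : Subset n) : Set where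
  field
    source  : Nonempty Q
    avoids  : ∀ u → u ∈ˢ Q → u ∉ˢ S
    sink    : ∃ λ w → w ∉ˢ Q × w ∉ˢ S
    no-exit : ∀ u w → u ∈ˢ Q → w ∉ˢ Q → w ∉ˢ S → ¬ Arc D u w

separates? : ∀ {n} (D : Digraph n) S Q → Dec (Separates D S Q)
separates? D S Q = map′
  (λ (a , b , c , d) → record { source = a ; avoids = b ; sink = c ; no-exit = d })
  (λ s → let open Separates s in source , avoids , sink , no-exit)
  (nonempty? Q ×-dec
   all? (λ u → (u ∈? Q) →-dec ¬? (u ∈? S)) ×-dec
   any? (λ w → ¬? (w ∈? Q) ×-dec ¬? (w ∈? S)) ×-dec
   all? (λ u → all? (λ w → (u ∈? Q) →-dec (¬? (w ∈? Q) →-dec (¬? (w ∈? S) →-dec ¬? (T? (arc D u w)))))))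

∣⁅x⁆∪p∣≤ : ∀ {n} (x : Fin n) p → ∣ ⁅ x ⁆ ∪ p ∣ ≤ suc ∣ p ∣
∣⁅x⁆∪p∣≤ x p = ≤-trans (∣p∪q∣≤ ⁅ x ⁆ p) (≤-reflexive (cong (_+ ∣ p ∣) (∣⁅x⁆∣≡1 x)))
  where
  ∣p∪q∣≤ : ∀ {n} (p q : Subset n) → ∣ p ∪ q ∣ ≤ ∣ p ∣ + ∣ q ∣
  ∣p∪q∣≤ Vec.[] Vec.[] = z≤n
  ∣p∪q∣≤ (false Vec.∷ p) (false Vec.∷ q) = ∣p∪q∣≤ p q
  ∣p∪q∣≤ (false Vec.∷ p) (true  Vec.∷ q) = ≤-trans (s≤s (∣p∪q∣≤ p q)) (≤-reflexive (sym (+-suc ∣ p ∣ ∣ q ∣)))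
  ∣p∪q∣≤ (true  Vec.∷ p) (false Vec.∷ q) = s≤s (∣p∪q∣≤ p q)
  ∣p∪q∣≤ (true  Vec.∷ p) (true  Vec.∷ q) = s≤s (≤-trans (∣p∪q∣≤ p q) (+-monoʳ-≤ ∣ p ∣ (n≤1+n ∣ q ∣)))

-- The set `Q` of vertices reached from `u` grows until it contains `v`; if no arc left it before
-- that, it would separate.
inseparable⇒connected : ∀ {n} (D : Digraph n) S → (∀ Q → ¬ Separates D S Q) → StronglyConnectedWithout D S
inseparable⇒connected {n} D S none u v u∉S v∉S =
  <-rec P step _ ⁅ u ⁆ refl (x∈⁅x⁆ u) (λ w w∈ → subst (λ y → y ∉ˢ S × Star (ArcAvoiding D S) u y)
    (sym (x∈⁅y⁆⇒x≡y u w∈)) (u∉S , ε))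
  where
  P : ℕ → Set
  P g = ∀ Q → n ∸ ∣ Q ∣ ≡ g → u ∈ˢ Q → (∀ w → w ∈ˢ Q → w ∉ˢ S × Star (ArcAvoiding D S) u w) →
    Star (ArcAvoiding D S) u v
  step : ∀ g → (∀ {h} → h < g → P h) → P g
  step g rec Q refl u∈Q reach with v ∈? Q
  ... | yes v∈Q = proj₂ (reach v v∈Q)
  ... | no v∉Q with any? (λ x → any? (λ y → (x ∈? Q) ×-dec ¬? (y ∈? Q) ×-dec ¬? (y ∈? S) ×-dec T? (arc D x y)))
  ...   | no stuck = ⊥-elim (none Q (record
    { source = u , u∈Q
    ; avoids = λ w w∈Q → proj₁ (reach w w∈Q)
    ; sink = v , v∉Q , v∉S
    ; no-exit = λ x y x∈Q y∉Q y∉S xy → stuck (x , y , x∈Q , y∉Q , y∉S , xy) }))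
  ...   | yes (x , y , x∈Q , y∉Q , y∉S , xy) = rec smaller (⁅ y ⁆ ∪ Q) refl (q⊆p∪q ⁅ y ⁆ Q u∈Q) reach′
    where
    smaller : n ∸ ∣ ⁅ y ⁆ ∪ Q ∣ < n ∸ ∣ Q ∣
    smaller = ∸-monoʳ-< (p⊂q⇒∣p∣<∣q∣ (q⊆p∪q ⁅ y ⁆ Q , y , p⊆p∪q Q (x∈⁅x⁆ y) , y∉Q)) (∣p∣≤n (⁅ y ⁆ ∪ Q))
    reach′ : ∀ w → w ∈ˢ ⁅ y ⁆ ∪ Q → w ∉ˢ S × Star (ArcAvoiding D S) u w
    reach′ w w∈ with x∈p∪q⁻ ⁅ y ⁆ Q w∈
    ... | inj₂ w∈Q = reach w w∈Q
    ... | inj₁ w∈y rewrite x∈⁅y⁆⇒x≡y y w∈y =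
      y∉S , (proj₂ (reach x x∈Q) ◅◅ ((proj₁ (reach x x∈Q) , y∉S , xy) ◅ ε))

exit : ∀ {n} (D : Digraph n) S Q {u v} → Star (ArcAvoiding D S) u v → u ∈ˢ Q → v ∉ˢ Q →
  ∃₂ λ x y → x ∈ˢ Q × y ∉ˢ Q × ArcAvoiding D S x y
exit D S Q ε u∈Q v∉Q = ⊥-elim (v∉Q u∈Q)
exit D S Q {u} (_◅_ {j = w} e path) u∈Q v∉Q with w ∈? Q
... | yes w∈Q = exit D S Q path w∈Q v∉Q
... | no w∉Q  = u , w , u∈Q , w∉Q , e

connected⇒inseparable : ∀ {n} (D : Digraph n) S Q → StronglyConnectedWithout D S → ¬ Separates D S Q
connected⇒inseparable D S Q conn sep with sep .Separates.source | sep .Separates.sink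
... | u , u∈Q | w , w∉Q , w∉S with exit D S Q (conn u w (sep .Separates.avoids u u∈Q) w∉S) u∈Q w∉Q
... | x , y , x∈Q , y∉Q , x∉S , y∉S , xy = sep .Separates.no-exit x y x∈Q y∉Q y∉S xy

-- The final case distinction, between no inversion and one, rests on this decision.
isStrong? : ∀ {n} k (D : Digraph n) → Dec (IsStrong k D)
isStrong? {n} k D = suc k ≤? n ×-dec map′
  (λ h S S<k → inseparable⇒connected D S (λ Q sep → h (S , S<k , Q , sep)))
  (λ conn (S , S<k , Q , sep) → connected⇒inseparable D S Q (conn S S<k) sep)
  (¬? (anySubset? (λ S → ∣ S ∣ <? k ×-dec anySubset? (separates? D S))))

isArcStrong? : ∀ {n} k (D : Digraph n) → Dec (IsArcStrong k D)
isArcStrong? k D = map′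
  (λ h V p q → ≮⇒≥ (λ lt → h (V , p , q , lt)))
  (λ h (V , p , q , lt) → <⇒≱ lt (h V p q))
  (¬? (anySubset? (λ V → nonempty? V ×-dec nonempty? (∁ V) ×-dec arcCount D V (∁ V) <? k)))

-- From strong to arc-strong digraphs

subsetOf : ∀ {n} → List (Fin n) → Subset n
subsetOf []       = ∅
subsetOf (x ∷ xs) = ⁅ x ⁆ ∪ subsetOf xs

∣subsetOf∣ : ∀ {n} (xs : List (Fin n)) → ∣ subsetOf xs ∣ ≤ length xs
∣subsetOf∣ {n} []       = ≤-reflexive (∣⊥∣≡0 n)
∣subsetOf∣     (x ∷ xs) = ≤-trans (∣⁅x⁆∪p∣≤ x (subsetOf xs)) (s≤s (∣subsetOf∣ xs))

∈subsetOf : ∀ {n} {x : Fin n} {xs} → x ∈ xs → x ∈ˢ subsetOf xs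
∈subsetOf {xs = y ∷ xs} (here refl) = p⊆p∪q (subsetOf xs) (x∈⁅x⁆ y)
∈subsetOf {xs = y ∷ xs} (there p)   = q⊆p∪q ⁅ y ⁆ (subsetOf xs) (∈subsetOf p)

subsetOf∈ : ∀ {n} {x : Fin n} xs → x ∈ˢ subsetOf xs → x ∈ xs
subsetOf∈ []       p = ⊥-elim (∉⊥ p)
subsetOf∈ (y ∷ xs) p with x∈p∪q⁻ ⁅ y ⁆ (subsetOf xs) p
... | inj₁ q = here (x∈⁅y⁆⇒x≡y y q)
... | inj₂ q = there (subsetOf∈ xs q)

missing : ∀ {n} (p : Subset n) → ∣ p ∣ < n → ∃ λ x → x ∉ˢ p
missing {n} p lt with any? (λ x → ¬? (x ∈? p))
... | yes h = h
... | no h = ⊥-elim (<⇒≱ lt (subst (_≤ ∣ p ∣) (∣⊤∣≡n n) (p⊆q⇒∣p∣≤∣q∣ {p = full} {q = p} all)))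
  where
  all : ∀ {x} → x ∈ˢ full → x ∈ˢ p
  all {x} _ with x ∈? p
  ... | yes q = q
  ... | no q  = ⊥-elim (h (x , q))

module _ {n : ℕ} (D : Digraph n) (V : Subset n) where

  crossing : List (Fin n × Fin n)
  crossing = filter (crosses? D V (∁ V)) (cartesianProduct (allFin n) (allFin n))

  ∈crossing : ∀ {u w} → u ∈ˢ V → w ∉ˢ V → Arc D u w → (u , w) ∈ crossing
  ∈crossing {u} {w} p q r = ∈-filter⁺ (crosses? D V (∁ V))
    (∈-cartesianProduct⁺ (∈-allFin u) (∈-allFin w)) (p , x∉p⇒x∈∁p q , r)

  -- For arcs leaving V and a non-arc (x , y) with x in V and y outside, this is neither x nor y.
  endpoint : Fin n → Fin n × Fin n → Fin n
  endpoint x (u , w) with u ≟ᶠ x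
  ... | yes _ = w
  ... | no  _ = u

  endpoint-≡ : ∀ x w → endpoint x (x , w) ≡ w
  endpoint-≡ x w with x ≟ᶠ x
  ... | yes _ = refl
  ... | no h  = ⊥-elim (h refl)

  endpoint-≢ : ∀ x {u} w → u ≢ x → endpoint x (u , w) ≡ u
  endpoint-≢ x {u} w h with u ≟ᶠ x
  ... | yes e = ⊥-elim (h e)
  ... | no _  = refl

  endpoints : Fin n → List (Fin n)
  endpoints x = map (endpoint x) crossing

  ∈endpoints : ∀ x {u w} → u ∈ˢ V → w ∉ˢ V → Arc D u w → endpoint x (u , w) ∈ endpoints x
  ∈endpoints x p q r = ∈-map⁺ (endpoint x) (∈crossing p q r)

  -- If `(x , y)` is an arc, then `x` and the endpoints of the crossing arcs miss some vertex `v`.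
  -- An arc from `x` to `v`, or from `v` to `y` if `v` is in `V`, would have `v` as its endpoint.
  non-arc : ∀ {x y} → x ∈ˢ V → y ∉ˢ V → suc (length crossing) < n →
    ∃₂ λ u w → u ∈ˢ V × w ∉ˢ V × ¬ Arc D u w
  non-arc {x} {y} x∈V y∉V small with T? (arc D x y)
  ... | no h = x , y , x∈V , y∉V , h
  ... | yes xy with missing (subsetOf (x ∷ endpoints x))
    (≤-<-trans (∣subsetOf∣ (x ∷ endpoints x)) (subst (λ l → suc l < n) (sym (length-map (endpoint x) crossing)) small))
  ...   | v , v∉ with v ∈? V
  ...     | no v∉V = x , v , x∈V , v∉V , λ xv → v∉ (∈subsetOf (there
    (subst (_∈ endpoints x) (endpoint-≡ x v) (∈endpoints x x∈V v∉V xv))))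
  ...     | yes v∈V = v , y , v∈V , y∉V , λ vy → v∉ (∈subsetOf (there
    (subst (_∈ endpoints x) (endpoint-≢ x y (λ e → v∉ (∈subsetOf {xs = x ∷ endpoints x} (here e)))) (∈endpoints x v∈V y∉V vy))))

  endpoint-either : ∀ x p → endpoint x p ≡ proj₁ p × proj₁ p ≢ x ⊎ endpoint x p ≡ proj₂ p × proj₁ p ≡ x
  endpoint-either x (u , w) with u ≟ᶠ x
  ... | yes e = inj₂ (refl , e)
  ... | no h  = inj₁ (refl , h)

  crossing⇒ : ∀ {u w} → (u , w) ∈ crossing → u ∈ˢ V × w ∉ˢ V × Arc D u w
  crossing⇒ p with ∈-filter⁻ (crosses? D V (∁ V)) {xs = cartesianProduct (allFin n) (allFin n)} p
  ... | _ , u∈V , w∈∁V , uw = u∈V , x∈∁p⇒x∉p w∈∁V , uw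

  -- Deleting one endpoint of each crossing arc, but neither end of a non-arc, leaves no crossing arc.
  few-crossings⇒disconnected : ∀ {u w} → u ∈ˢ V → w ∉ˢ V → ¬ Arc D u w →
    ¬ StronglyConnectedWithout D (subsetOf (endpoints u))
  few-crossings⇒disconnected {u} {w} u∈V w∉V ¬uw conn
    with exit D (subsetOf (endpoints u)) V (conn u w u∉S w∉S) u∈V w∉V
    where
    u∉S : u ∉ˢ subsetOf (endpoints u)
    u∉S u∈S with ∈-map⁻ (endpoint u) (subsetOf∈ (endpoints u) u∈S)
    ... | (a , b) , ab , e with endpoint-either u (a , b) | crossing⇒ ab
    ...   | inj₁ (e′ , a≢u) | _ = a≢u (sym (trans e e′))
    ...   | inj₂ (e′ , _) | _ , b∉V , _ = b∉V (subst (_∈ˢ V) (trans e e′) u∈V)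
    w∉S : w ∉ˢ subsetOf (endpoints u)
    w∉S w∈S with ∈-map⁻ (endpoint u) (subsetOf∈ (endpoints u) w∈S)
    ... | (a , b) , ab , e with endpoint-either u (a , b) | crossing⇒ ab
    ...   | inj₁ (e′ , _) | a∈V , _ , _ = w∉V (subst (_∈ˢ V) (sym (trans e e′)) a∈V)
    ...   | inj₂ (e′ , refl) | _ , _ , arc-ab = ¬uw (subst (Arc D u) (sym (trans e e′)) arc-ab)
  ... | p , q , p∈V , q∉V , p∉S , q∉S , pq with endpoint-either u (p , q) | ∈subsetOf (∈endpoints u p∈V q∉V pq)
  ...   | inj₁ (e , _) | h = p∉S (subst (_∈ˢ subsetOf (endpoints u)) e h)
  ...   | inj₂ (e , _) | h = q∉S (subst (_∈ˢ subsetOf (endpoints u)) e h)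

-- Fewer than `k` crossing arcs leave room for a non-arc `(u , w)` across the cut, and deleting one
-- endpoint of each crossing arc then separates `u` from `w` by fewer than `k` vertices.
strong⇒arcStrong : ∀ {n} k (D : Digraph n) → IsStrong k D → IsArcStrong k D
strong⇒arcStrong {n} k D (k<n , conn) V (x , x∈V) (y , y∈∁V) with k ≤? arcCount D V (∁ V)
... | yes h = h
... | no h with non-arc D V x∈V (x∈∁p⇒x∉p y∈∁V) (≤-trans (s≤s (≰⇒> h)) k<n)
...   | u , w , u∈V , w∉V , ¬uw = ⊥-elim (few-crossings⇒disconnected D V u∈V w∉V ¬uw
  (conn (subsetOf (endpoints D V u)) (≤-<-trans (∣subsetOf∣ (endpoints D V u))
    (subst (_< k) (sym (length-map (endpoint D V u) (crossing D V))) (≰⇒> h)))))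

-- From median orders back to tournaments

∉⇒lookup : ∀ {n} {u : Fin n} p → u ∉ˢ p → Vec.lookup p u ≡ false
∉⇒lookup {u = u} p h with Vec.lookup p u in e
... | true  = ⊥-elim (h (lookup⇒[]= u p e))
... | false = refl

lookup⇒∉ : ∀ {n} {u : Fin n} p → Vec.lookup p u ≡ false → u ∉ˢ p
lookup⇒∉ p e h = true≢false ([]=⇒lookup h) e

module _ {n : ℕ} (D : Digraph n) (A : Arrangement D) (X : ℕ → Bool) where
  open Arrangement A

  inverted : Subset n
  inverted = Vec.tabulate (X ∘ place)

  inverted-arc : ∀ i j → i < n → j < n → arc (invert D inverted) (vertex i) (vertex j) ≡ flip t X i j
  inverted-arc i j i<n j<n
    rewrite lookup∘tabulate (X ∘ place) (vertex i) | lookup∘tabulate (X ∘ place) (vertex j)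
          | place-vertex i i<n | place-vertex j j<n | t-arc i j | t-arc j i = refl

  separation⇒cut : ∀ {k} S Q → ∣ S ∣ ≤ k → Separates (invert D inverted) S Q → Cut order X k
  separation⇒cut {k} S Q few sep = record
    { Q      = q
    ; N      = λ i → not (q i) ∧ not (s i)
    ; S      = s
    ; some   = λ i _ → some (q i) (s i)
    ; Q∩N    = λ i → disjoint (q i) (s i)
    ; closed = λ i j i<n j<n qi nj → trans (sym (inverted-arc i j i<n j<n))
        (¬T (no-exit (vertex i) (vertex j) (lookup⇒[]= (vertex i) Q qi)
          (lookup⇒∉ Q (not-true (∧-trueˡ (not (q j)) nj))) (lookup⇒∉ S (not-true (∧-trueʳ (not (q j)) nj)))))
    ; few    = subst (_≤ k) (sym (count-subset S)) few
    }
    where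
    open Separates sep
    q s : ℕ → Bool
    q = Vec.lookup Q ∘ vertex
    s = Vec.lookup S ∘ vertex
    some : ∀ a b → a ≡ false → not a ∧ not b ≡ false → b ≡ true
    some false true _ _ = refl
    disjoint : ∀ a b → a ≡ true → not a ∧ not b ≡ true → ⊥
    disjoint true b _ ()
    ¬T : ∀ {b} → ¬ T b → b ≡ false
    ¬T {false} _ = refl
    ¬T {true}  h = ⊥-elim (h tt)

  no-cut⇒inseparable : ∀ {k} → NoCut order X k → ∀ S Q → ∣ S ∣ ≤ k → ¬ Separates (invert D inverted) S Q
  no-cut⇒inseparable none S Q few sep with sep .Separates.source | sep .Separates.sink
  ... | u , u∈Q | w , w∉Q , w∉S = none (separation⇒cut S Q few sep) (place u) (place w) (place< u) (place< w)
    (trans (cong (Vec.lookup Q) (vertex-place u)) ([]=⇒lookup u∈Q))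
    (∧-true (cong not (trans (cong (Vec.lookup Q) (vertex-place w)) (∉⇒lookup Q w∉Q)))
            (cong not (trans (cong (Vec.lookup S) (vertex-place w)) (∉⇒lookup S w∉S))))

-- For connectivity `k + 1` the deleted sets have at most `k` vertices, which is the bound in `Cut`.
one-inversion : ∀ {n} k (D : Digraph n) → IsTournament D → 19 * k + 17 ≤ n →
  ∃ λ X → IsStrong (suc k) (invert D X)
one-inversion {n} k D tour n≥ = inverted D A (proj₁ choice) , ≤-trans (linear (18 * k + 15) ≤-refl (id k)) n≥ ,
  λ S S<k → inseparable⇒connected _ S
    (λ Q → no-cut⇒inseparable D A (proj₁ choice) (proj₂ choice) S Q (≤-pred S<k))
  where
  0<n : 0 < n
  0<n = ≤-trans (≤-trans (s≤s z≤n) (m≤n+m 17 (19 * k))) n≥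
  A : Arrangement D
  A = arrangement D tour (fromℕ< 0<n)
  choice : ∃ λ X → NoCut (Arrangement.order A) X k
  choice = inversion-exists (Arrangement.order A) k n≥
  id : ∀ k → suc (suc k) + 0 + (18 * k + 15) ≡ 19 * k + 17 + 0
  id = solve-∀

-- The minimum numbers of inversions

module _ {n : ℕ} (P : Digraph n → Set) (D : Digraph n) where

  minimum-0 : P D → IsMinimum (ReachableBy P D) 0
  minimum-0 p = ([] , refl , p) , λ _ _ → z≤n

  minimum-1 : ¬ P D → ∀ X → P (invert D X) → IsMinimum (ReachableBy P D) 1
  minimum-1 ¬p X p = (X ∷ [] , refl , p) , λ where
    zero    ([] , _ , q) → ⊥-elim (¬p q)
    (suc j) _            → s≤s z≤n

theorem1p10 : ∀ (n k : ℕ) → 1 ≤ n → 1 ≤ k → n ≥ 19 * k ∸ 2 →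
    (T : Digraph n) → IsTournament T →
    ∃₂ λ s′ s → IsSinv′ k T s′ × IsSinv k T s × s′ ≤ s × s ≤ 1
theorem1p10 n (suc k) _ _ n≥ T tour =
  -- With `k + 1` for the connectivity, the bound `19 (k + 1) - 2` is `19 k + 17`.
  minima (one-inversion k T tour (subst (_≤ n) (trans (cong (_∸ 2) (id k)) (m+n∸m≡n 2 (19 * k + 17))) n≥))
    (isStrong? (suc k) T) (isArcStrong? (suc k) T)
  where
  id : ∀ k → 19 * suc k ≡ 2 + (19 * k + 17)
  id = solve-∀
  minima : (∃ λ X → IsStrong (suc k) (invert T X)) → Dec (IsStrong (suc k) T) → Dec (IsArcStrong (suc k) T) →
    ∃₂ λ s′ s → IsSinv′ (suc k) T s′ × IsSinv (suc k) T s × s′ ≤ s × s ≤ 1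
  minima _ (yes p) (yes q) = 0 , 0 , minimum-0 (IsArcStrong (suc k)) T q , minimum-0 (IsStrong (suc k)) T p , z≤n , z≤n
  minima _ (yes p) (no ¬q) = ⊥-elim (¬q (strong⇒arcStrong (suc k) T p))
  minima (X , strong) (no ¬p) (yes q) = 0 , 1 , minimum-0 (IsArcStrong (suc k)) T q , minimum-1 (IsStrong (suc k)) T ¬p X strong , z≤n , s≤s z≤n
  minima (X , strong) (no ¬p) (no ¬q) = 1 , 1 ,
    minimum-1 (IsArcStrong (suc k)) T ¬q X (strong⇒arcStrong (suc k) (invert T X) strong) ,
    minimum-1 (IsStrong (suc k)) T ¬p X strong , s≤s z≤n , s≤s z≤n
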